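{- Let $q$ be a prime power and $m,n$ positive integers. If $h_q(mn)=0$, then $h_{\tau_3}(\mathbb{F}_q^{mn})=0$, and hence $h_{q^m}(n)=0$. Similarly, if $h_q(mn)\le m-1$, then $h_{q^m}(n)=0$.
   Context: For a prime power $Q$ and $N\in\mathbb{N}$, with $\tau$ the cyclic shift $(u_1,\dots,u_N)\mapsto(u_N,u_1,\dots,u_{N-1})$ on $\mathbb{F}_Q^N$, a subspace $U$ is cyclically covering if $\bigcup_{i=0}^{N-1}\tau^i(U)=\mathbb{F}_Q^N$, and $h_Q(N)$ is the largest codimension of a cyclically covering subspace of $\mathbb{F}_Q^N$. Write vectors of $\mathbb{F}_q^{mn}$ as $(b_1,\dots,b_n)$ with blocks $b_i\in\mathbb{F}_q^m$ and let $\tau_3(b_1,\dots,b_n)=(b_n,b_1,\dots,b_{n-1})$. A subspace $U\subseteq\mathbb{F}_q^{mn}$ is a $\tau_3$-covering if $\bigcup_{k=0}^{n-1}\tau_3^k(U)=\mathbb{F}_q^{mn}$, and $h_{\tau_3}(\mathbb{F}_q^{mn})$ is the largest codimension of a $\tau_3$-covering subspace. -}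

module Defs where

open import Level using (0ℓ)
open import Data.Nat using (ℕ; zero; suc; _∸_; _≤_; _<_; _^_) renaming (_*_ to _*ℕ_)
open import Data.Nat.Primality using (Prime)
open import Data.Fin using (Fin; zero; suc; fromℕ; inject₁; toℕ)
open import Data.Product using (Σ; ∃; _×_; _,_)
open import Function using (_∘_)
open import Relation.Nullary using (¬_)
open import Relation.Binary.PropositionalEquality using (_≡_; setoid)
open import Algebra.Bundles using (CommutativeRing)
open import Function.Bundles using (Inverse)

IsPrimePower : ℕ → Set
IsPrimePower q = Σ ℕ λ p → Σ ℕ λ k → Prime p × 0 < k × q ≡ p ^ k

record Field : Set₁ where
  field
    cring : CommutativeRing 0ℓ 0ℓ
  open CommutativeRing cring public
  field
    1≉0     : ¬ (1# ≈ 0#)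
    inverse : ∀ x → ¬ (x ≈ 0#) → ∃ λ y → x * y ≈ 1#

HasCard : Field → ℕ → Set
HasCard F Q = Inverse (setoid (Fin Q)) (Field.setoid F)

iter : ∀ {A : Set} → (A → A) → ℕ → A → A
iter f zero    x = x
iter f (suc k) x = f (iter f k x)

cpred : ∀ {N} → Fin N → Fin N
cpred {suc k} zero    = fromℕ k
cpred {suc k} (suc i) = inject₁ i

module LinAlg (F : Field) (I : Set) where
  open Field F using (Carrier; _≈_; _+_; _*_; 0#)

  V : Set
  V = I → Carrier

  _≈ᵥ_ : V → V → Set
  u ≈ᵥ v = ∀ x → u x ≈ v x

  0ᵥ : V
  0ᵥ _ = 0#

  _+ᵥ_ : V → V → V
  (u +ᵥ v) x = u x + v x

  _·ᵥ_ : Carrier → V → V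
  (a ·ᵥ v) x = a * v x

  lincomb : ∀ d → (Fin d → Carrier) → (Fin d → V) → V
  lincomb zero    c b = 0ᵥ
  lincomb (suc d) c b = (c zero ·ᵥ b zero) +ᵥ lincomb d (c ∘ suc) (b ∘ suc)

  record IsSubspace (U : V → Set) : Set where
    field
      resp  : ∀ {u v} → u ≈ᵥ v → U u → U v
      zero∈ : U 0ᵥ
      +∈    : ∀ {u v} → U u → U v → U (u +ᵥ v)
      ·∈    : ∀ a {u} → U u → U (a ·ᵥ u)

  HasDim : (V → Set) → ℕ → Set
  HasDim U d = Σ (Fin d → V) λ b →
      (∀ i → U (b i))
    × (∀ c → lincomb d c b ≈ᵥ 0ᵥ → ∀ i → c i ≈ 0#)
    × (∀ u → U u → ∃ λ c → u ≈ᵥ lincomb d c b)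

  -- the shift induced by a permutation σ of coordinates: (S u)(x) = u(σ x)
  -- U is covering for the t maps S^0,…,S^{t-1}
  Covering : (I → I) → ℕ → (V → Set) → Set
  Covering σ t U = ∀ v → Σ (Fin t) λ k → Σ V λ u →
    U u × (v ≈ᵥ (λ x → u (iter σ (toℕ k) x)))

  -- "the largest codimension of a covering subspace is ≤ h",
  -- the ambient space F^I having dimension N
  MaxCodimLe : ℕ → (I → I) → ℕ → ℕ → Set₁
  MaxCodimLe N σ t h = ∀ (U : V → Set) → IsSubspace U → Covering σ t U →
    ∀ d → HasDim U d → N ∸ d ≤ h

-- h_Q(N) ≤ h, computed with a field F of cardinality Q:
-- τ(u_1,…,u_N) = (u_N,u_1,…,u_{N-1}), i.e. τ(u)_i = u_{i-1 mod N}
hLe : (F : Field) → (N : ℕ) → ℕ → Set₁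
hLe F N h = LinAlg.MaxCodimLe F (Fin N) N cpred N h

-- h_{τ₃}(F^{mn}) ≤ h : vectors (b_1,…,b_n), b_i ∈ F^m, indexed by Fin n × Fin m,
-- τ₃(b_1,…,b_n) = (b_n,b_1,…,b_{n-1})
τ₃idx : ∀ {n m} → Fin n × Fin m → Fin n × Fin m
τ₃idx (i , j) = (cpred i , j)

hτ₃Le : (F : Field) → (m n : ℕ) → ℕ → Set₁
hτ₃Le F m n h = LinAlg.MaxCodimLe F (Fin n × Fin m) (m *ℕ n) τ₃idx n h

module Submission where

-- Cutting F^{mn} into n blocks of length m, τ^m is the block shift τ₃, so every τ₃-covering subspace is
-- cyclically covering. A cyclically covering K-subspace of K^n of dimension d becomes, in coordinates with
-- respect to an F-basis of K of size m, a τ₃-covering F-subspace of dimension dm, hence of codimension m(n - d).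
--
-- F and K are only given by their cardinalities, so F has to be embedded into K. The elements α of F are adjoined
-- one at a time: the minimal polynomial f of α over the part R already mapped to K divides X^Q - X, where Q = |K|,
-- and X^Q - X vanishes on all of K; counting roots, f has a root a in K, and α ↦ a extends the map to R[α].

open import Defs
import Algebra.Properties.CommutativeMonoid.Sum as MonoidSum
import Algebra.Properties.Group as GroupProperties
import Algebra.Properties.Ring as RingProperties
import Algebra.Properties.Semiring.Exp as SemiringExp
import Algebra.Properties.Semiring.Mult as SemiringMult
import Algebra.Properties.Semiring.Sum as SemiringSum
import Algebra.Solver.Ring.NaturalCoefficients.Default as SemiringSolver
open import Data.Fin using (Fin; zero; suc)
import Data.Fin as Fin
import Data.Fin.Properties as Fin
open import Data.List as List using (List; []; _∷_)
open import Data.Nat as ℕ using (ℕ; zero; suc; z≤n; s≤s; _∸_)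
open import Data.Nat.Coprimality using (Coprime; coprime-Bézout)
open import Data.Nat.Divisibility using (_∣_; _∣?_; divides)
open import Data.Nat.GCD using (module Bézout)
open import Data.Nat.Primality using (Prime; prime⇒irreducible; prime⇒nonZero)
import Data.Nat.Properties as ℕ
open import Data.Product using (∃; ∃₂; _×_; _,_; proj₁; proj₂)
open import Data.Sum using (_⊎_; inj₁; inj₂)
open import Data.Vec as Vec using (Vec; []; _∷_)
import Data.Vec.Functional as VecF
open import Function using (_∘_; case_of_)
open import Function.Bundles using (Inverse; _↔_; mk↔ₛ′)
open import Relation.Binary.PropositionalEquality as ≡ using (_≡_)
import Relation.Binary.Reasoning.Setoid as SetoidReasoning
open import Relation.Nullary using (¬_; Dec; yes; no; contradiction)
open import Relation.Nullary.Decidable using (map′; ¬¬-excluded-middle; decidable-stable)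

-- Finite fields

-- The ring R is never built. Its elements are the values in F of formal expressions in the elements
-- adjoined so far, and a homomorphism from R to K is a choice of images for these generators under
-- which every expression that vanishes in F vanishes in K. A polynomial whose coefficients are
-- expressions then has a meaning over both fields at once, so division with remainder is carried
-- out once, on syntax, and interpreted twice. The price is that a coefficient may evaluate to 0
-- without looking like 0, so degrees cannot be read off. Therefore only monic polynomials serve as
-- divisors, and minimality of the degree of f does the work of irreducibility: a polynomial over R
-- of smaller degree that vanishes at α has only zero coefficients, hence its image over K vanishes
-- everywhere. The least degree ranges over relations with arbitrary expressions as coefficients; it
-- is obtained under double negation, without deciding which degrees occur.

module FieldProperties (L : Field) where
  open Field L hiding (zero)
  open SetoidReasoning setoid
  open RingProperties ring using ([y-z]x≈yx-zx) public
  open GroupProperties +-group public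
    using () renaming (x∙y⁻¹≈ε⇒x≈y to x-y≈0⇒x≈y; x≈y⇒x∙y⁻¹≈ε to x≈y⇒x-y≈0; identityˡ-unique to +-identityˡ-unique;
      inverseʳ-unique to +-inverseʳ-unique)
  open SemiringExp semiring using (_^_; ^-assocʳ; ^-congˡ) public
  open SemiringMult semiring public
    using (×-homo-1; ×-homo-+; ×1-homo-*) renaming (_×_ to _×ₙ_)
  open SemiringSolver commutativeSemiring using (solve; _:=_; _:+_; _:*_; con) public

  no-zero-divisors : ∀ {x w} → ¬ x ≈ 0# → x * w ≈ 0# → w ≈ 0#
  no-zero-divisors {x} {w} x≉0 xw≈0 with inverse x x≉0
  ... | y , xy≈1 = begin
    w            ≈⟨ *-identityˡ w ⟨
    1# * w       ≈⟨ *-congʳ (trans (*-comm y x) xy≈1) ⟨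
    (y * x) * w  ≈⟨ *-assoc y x w ⟩
    y * (x * w)  ≈⟨ *-congˡ xw≈0 ⟩
    y * 0#       ≈⟨ zeroʳ y ⟩
    0#           ∎

  ≉-cancel : ∀ {a b w} → ¬ a ≈ b → a * w ≈ b * w → w ≈ 0#
  ≉-cancel {a} {b} {w} a≉b aw≈bw =
    no-zero-divisors (a≉b ∘ x-y≈0⇒x≈y a b) (trans ([y-z]x≈yx-zx w a b) (x≈y⇒x-y≈0 aw≈bw))

  *-cancelʳ-≉0 : ∀ {a b w} → ¬ w ≈ 0# → a * w ≈ b * w → a ≈ b
  *-cancelʳ-≉0 {a} {b} {w} w≉0 aw≈bw = x-y≈0⇒x≈y a b (no-zero-divisors w≉0 (begin
    w * (a - b)    ≈⟨ *-comm w (a - b) ⟩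
    (a - b) * w    ≈⟨ [y-z]x≈yx-zx w a b ⟩
    a * w - b * w  ≈⟨ x≈y⇒x-y≈0 aw≈bw ⟩
    0#             ∎))

  x+-1*x≈0 : ∀ x → x + (- 1#) * x ≈ 0#
  x+-1*x≈0 x = begin
    x + (- 1#) * x       ≈⟨ +-congʳ (*-identityˡ x) ⟨
    1# * x + (- 1#) * x  ≈⟨ distribʳ x 1# (- 1#) ⟨
    (1# - 1#) * x        ≈⟨ *-congʳ (-‿inverseʳ 1#) ⟩
    0# * x               ≈⟨ zeroˡ x ⟩
    0#                   ∎

  x+-1*y≈0⇒x≈y : ∀ {x y} → x + (- 1#) * y ≈ 0# → x ≈ y
  x+-1*y≈0⇒x≈y {x} {y} eq = begin
    x                         ≈⟨ +-identityʳ x ⟨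
    x + 0#                    ≈⟨ +-congˡ (x+-1*x≈0 y) ⟨
    x + (y + (- 1#) * y)      ≈⟨ solve 3 (λ x y z → x :+ (y :+ z) := y :+ (x :+ z)) refl x y ((- 1#) * y) ⟩
    y + (x + (- 1#) * y)      ≈⟨ +-congˡ eq ⟩
    y + 0#                    ≈⟨ +-identityʳ y ⟩
    y                         ∎

module FiniteField (L : Field) (Q : ℕ) (card : HasCard L Q) where
  open Field L hiding (zero)
  open FieldProperties L
  open Inverse card public using () renaming (to to elt; from to idx; from-cong to idx-cong;
    strictlyInverseˡ to elt-idx; strictlyInverseʳ to idx-elt)
  open SetoidReasoning setoid
  private
    module ∑ = MonoidSum +-commutativeMonoid
    module ∏ = MonoidSum *-commutativeMonoid

  idx-injective : ∀ {x y} → idx x ≡ idx y → x ≈ y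
  idx-injective {x} {y} eq = begin
    x            ≈⟨ elt-idx x ⟨
    elt (idx x)  ≡⟨ ≡.cong elt eq ⟩
    elt (idx y)  ≈⟨ elt-idx y ⟩
    y            ∎

  elt-injective : ∀ i j → elt i ≈ elt j → i ≡ j
  elt-injective i j eq = ≡.trans (≡.sym (idx-elt i)) (≡.trans (idx-cong eq) (idx-elt j))

  infix 4 _≟_
  _≟_ : ∀ x y → Dec (x ≈ y)
  x ≟ y = map′ idx-injective idx-cong (idx x Fin.≟ idx y)

  -- The elements 0 and 1 are distinct. This allows |K| to be written as `suc (suc Q)`, and
  -- exponents to be compared through powers of q.
  1<Q : 1 ℕ.< Q
  1<Q = Fin.injective⇒≤ {f = pair} pair-injective
    where
    pair : Fin 2 → Fin Q
    pair zero    = idx 0#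
    pair (suc _) = idx 1#
    pair-injective : ∀ {i j} → pair i ≡ pair j → i ≡ j
    pair-injective {zero}     {zero}     eq = ≡.refl
    pair-injective {zero}     {suc zero} eq = contradiction (sym (idx-injective eq)) 1≉0
    pair-injective {suc zero} {zero}     eq = contradiction (idx-injective eq) 1≉0
    pair-injective {suc zero} {suc zero} eq = ≡.refl

  permutation : (f g : Carrier → Carrier) → (∀ {x y} → x ≈ y → f x ≈ f y) → (∀ {x y} → x ≈ y → g x ≈ g y) →
                (∀ x → f (g x) ≈ x) → (∀ x → g (f x) ≈ x) → Fin Q ↔ Fin Q
  permutation f g f-cong g-cong fg gf = mk↔ₛ′ (idx ∘ f ∘ elt) (idx ∘ g ∘ elt)
    (λ i → ≡.trans (idx-cong (trans (f-cong (elt-idx _)) (fg (elt i)))) (idx-elt i))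
    (λ i → ≡.trans (idx-cong (trans (g-cong (elt-idx _)) (gf (elt i)))) (idx-elt i))

  -- Adding 1 permutes L, so ∑ x = Q × 1 + ∑ x.
  Q×1≈0 : Q ×ₙ 1# ≈ 0#
  Q×1≈0 = +-identityˡ-unique (Q ×ₙ 1#) (∑.sum elt) (begin
    Q ×ₙ 1# + ∑.sum elt               ≈⟨ +-congʳ (∑.sum-replicate Q) ⟨
    ∑.sum {Q} (λ _ → 1#) + ∑.sum elt  ≈⟨ ∑.∑-distrib-+ {Q} (λ _ → 1#) elt ⟨
    ∑.sum (λ i → 1# + elt i)          ≈⟨ ∑.sum-cong-≋ (λ i → elt-idx (1# + elt i)) ⟨
    ∑.sum (λ i → elt (idx (1# + elt i))) ≈⟨ ∑.sum-permute elt shift ⟨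
    ∑.sum elt                         ∎)
    where
    shift : Fin Q ↔ Fin Q
    shift = permutation (1# +_) ((- 1#) +_) +-congˡ +-congˡ
      (λ x → trans (sym (+-assoc 1# (- 1#) x)) (trans (+-congʳ (-‿inverseʳ 1#)) (+-identityˡ x)))
      (λ x → trans (sym (+-assoc (- 1#) 1# x)) (trans (+-congʳ (-‿inverseˡ 1#)) (+-identityˡ x)))

  onZero : Carrier → Carrier → Carrier → Carrier
  onZero a b z with z ≟ 0#
  ... | yes _ = a
  ... | no  _ = b

  onZero-yes : ∀ {a b z} → z ≈ 0# → onZero a b z ≈ a
  onZero-yes {z = z} z≈0 with z ≟ 0#
  ... | yes _   = refl
  ... | no z≉0 = contradiction z≈0 z≉0

  onZero-no : ∀ {a b z} → ¬ z ≈ 0# → onZero a b z ≈ b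
  onZero-no {z = z} z≉0 with z ≟ 0#
  ... | yes z≈0 = contradiction z≈0 z≉0
  ... | no _   = refl

  ∏-single : ∀ {n} (t : Fin n → Carrier) i → (∀ j → ¬ j ≡ i → t j ≈ 1#) → ∏.sum t ≈ t i
  ∏-single {suc n} t zero    t≈1 = begin
    t zero * ∏.sum (t ∘ suc)         ≈⟨ *-congˡ (∏.sum-cong-≋ (λ j → t≈1 (suc j) λ ())) ⟩
    t zero * ∏.sum {n} (λ _ → 1#)    ≈⟨ *-congˡ (∏.sum-replicate-zero n) ⟩
    t zero * 1#                      ≈⟨ *-identityʳ _ ⟩
    t zero                           ∎
  ∏-single {suc n} t (suc i) t≈1 = begin
    t zero * ∏.sum (t ∘ suc)  ≈⟨ *-cong (t≈1 zero λ ())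
                                   (∏-single (t ∘ suc) i (λ j j≢i → t≈1 (suc j) (j≢i ∘ Fin.suc-injective))) ⟩
    1# * t (suc i)            ≈⟨ *-identityˡ _ ⟩
    t (suc i)                 ∎

  ∏-nonzero : ∀ {n} (t : Fin n → Carrier) → (∀ i → ¬ t i ≈ 0#) → ¬ ∏.sum t ≈ 0#
  ∏-nonzero {zero}  t t≉0 eq = 1≉0 eq
  ∏-nonzero {suc n} t t≉0 eq = ∏-nonzero (t ∘ suc) (t≉0 ∘ suc) (no-zero-divisors (t≉0 zero) eq)

  -- w replaces 0 by 1; multiplication by x permutes L, and w (x z) is x w(z) except at z = 0,
  -- which accounts for the missing factor x.
  fermat-nonzero : ∀ {x} → ¬ x ≈ 0# → x ^ Q ≈ x
  fermat-nonzero {x} x≉0 = *-cancelʳ-≉0 W≉0 (begin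
    x ^ Q * ∏.sum (w ∘ elt)                               ≈⟨ *-congʳ (∏.sum-replicate Q) ⟨
    ∏.sum {Q} (λ _ → x) * ∏.sum (w ∘ elt)                 ≈⟨ ∏.∑-distrib-+ {Q} (λ _ → x) (w ∘ elt) ⟨
    ∏.sum (λ i → x * w (elt i))                           ≈⟨ ∏.sum-cong-≋ (λ i → scale (elt i)) ⟨
    ∏.sum (λ i → v (elt i) * w (x * elt i))               ≈⟨ ∏.∑-distrib-+ (v ∘ elt) (λ i → w (x * elt i)) ⟩
    ∏.sum (v ∘ elt) * ∏.sum (λ i → w (x * elt i))         ≈⟨ *-cong ∏v≈x ∏wx≈∏w ⟩
    x * ∏.sum (w ∘ elt)                                   ∎)
    where
    w v : Carrier → Carrier
    w z = onZero 1# z z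
    v z = onZero x 1# z

    w-cong : ∀ {y z} → y ≈ z → w y ≈ w z
    w-cong {y} {z} y≈z with z ≟ 0#
    ... | yes z≈0 = onZero-yes (trans y≈z z≈0)
    ... | no z≉0 = trans (onZero-no (z≉0 ∘ trans (sym y≈z))) y≈z

    w≉0 : ∀ z → ¬ w z ≈ 0#
    w≉0 z with z ≟ 0#
    ... | yes _   = 1≉0
    ... | no z≉0 = z≉0

    W≉0 : ¬ ∏.sum (w ∘ elt) ≈ 0#
    W≉0 = ∏-nonzero (w ∘ elt) (w≉0 ∘ elt)

    scale : ∀ z → v z * w (x * z) ≈ x * w z
    scale z with z ≟ 0#
    ... | yes z≈0 = *-congˡ (onZero-yes (trans (*-congˡ z≈0) (zeroʳ x)))
    ... | no z≉0 = trans (*-identityˡ _) (onZero-no (z≉0 ∘ no-zero-divisors x≉0))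

    ∏v≈x : ∏.sum (v ∘ elt) ≈ x
    ∏v≈x = trans
      (∏-single (v ∘ elt) (idx 0#) (λ j j≢ → onZero-no (λ e → j≢ (≡.trans (≡.sym (idx-elt j)) (idx-cong e)))))
      (onZero-yes (elt-idx 0#))

    y : Carrier
    y = proj₁ (inverse x x≉0)

    xy≈1 : x * y ≈ 1#
    xy≈1 = proj₂ (inverse x x≉0)

    scaling : Fin Q ↔ Fin Q
    scaling = permutation (x *_) (y *_) *-congˡ *-congˡ
      (λ z → trans (sym (*-assoc x y z)) (trans (*-congʳ xy≈1) (*-identityˡ z)))
      (λ z → trans (sym (*-assoc y x z)) (trans (*-congʳ (trans (*-comm y x) xy≈1)) (*-identityˡ z)))

    ∏wx≈∏w : ∏.sum (λ i → w (x * elt i)) ≈ ∏.sum (w ∘ elt)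
    ∏wx≈∏w = begin
      ∏.sum (λ i → w (x * elt i))              ≈⟨ ∏.sum-cong-≋ (λ i → w-cong (elt-idx (x * elt i))) ⟨
      ∏.sum (λ i → w (elt (idx (x * elt i))))  ≈⟨ ∏.sum-permute (w ∘ elt) scaling ⟨
      ∏.sum (w ∘ elt)                          ∎

  fermat : ∀ x → x ^ Q ≈ x
  fermat x with x ≟ 0#
  ... | no x≉0 = fermat-nonzero x≉0
  -- `idx 0#` inhabits `Fin Q` and so shows that the exponent Q is positive.
  ... | yes x≈0 = trans (^-congˡ Q x≈0) (trans (0^n≈0 (idx 0#)) (sym x≈0))
    where
    0^n≈0 : ∀ {n} → Fin n → 0# ^ n ≈ 0#
    0^n≈0 {suc n} _ = zeroˡ _

  fermat-iterated : ∀ m x → x ^ (Q ℕ.^ m) ≈ x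
  fermat-iterated zero    x = *-identityʳ x
  fermat-iterated (suc m) x = begin
    x ^ (Q ℕ.* Q ℕ.^ m)   ≈⟨ ^-assocʳ x Q (Q ℕ.^ m) ⟨
    (x ^ Q) ^ (Q ℕ.^ m)   ≈⟨ ^-congˡ (Q ℕ.^ m) (fermat x) ⟩
    x ^ (Q ℕ.^ m)         ≈⟨ fermat-iterated m x ⟩
    x                     ∎

  -- Q × 1 is the k-th power of p × 1 and vanishes, so p × 1 vanishes for lack of zero divisors; k =
  -- 0 would give 1 = 0.
  p×1≈0 : ∀ {p} k → Q ≡ p ℕ.^ k → p ×ₙ 1# ≈ 0#
  p×1≈0 {p} k Q≡p^k = base k (≡.subst (λ n → n ×ₙ 1# ≈ 0#) Q≡p^k Q×1≈0)
    where
    base : ∀ k → (p ℕ.^ k) ×ₙ 1# ≈ 0# → p ×ₙ 1# ≈ 0#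
    base zero    eq = contradiction (trans (sym (×-homo-1 1#)) eq) 1≉0
    base (suc k) eq with p ×ₙ 1# ≟ 0#
    ... | yes p≈0 = p≈0
    ... | no p≉0 = base k (no-zero-divisors p≉0 (trans (sym (×1-homo-* p (p ℕ.^ k))) eq))

-- Polynomials over the expressions in n generators

-- Syntax instead of elements: the same expression is evaluated in F at the generators and in K at
-- their images.
data Expr (n : ℕ) : Set where
  `0 `1 `-1 : Expr n
  gen       : Fin n → Expr n
  _`+_ _`*_ : Expr n → Expr n → Expr n

infixl 6 _`+_
infixl 7 _`*_

_`^_ : ∀ {n} → Expr n → ℕ → Expr n
e `^ zero  = `1
e `^ suc k = e `* (e `^ k)

-- X^{Q+2} - X
frobenius : ∀ {n} Q → Vec (Expr n) (suc (suc Q))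
frobenius Q = `0 ∷ `-1 ∷ Vec.replicate Q `0

module Evaluation (L : Field) where
  open Field L hiding (zero)
  open FieldProperties L
  open SetoidReasoning setoid

  ⟦_⟧ : ∀ {n} → Expr n → (Fin n → Carrier) → Carrier
  ⟦ `0 ⟧     ρ = 0#
  ⟦ `1 ⟧     ρ = 1#
  ⟦ `-1 ⟧    ρ = - 1#
  ⟦ gen i ⟧  ρ = ρ i
  ⟦ a `+ b ⟧ ρ = ⟦ a ⟧ ρ + ⟦ b ⟧ ρ
  ⟦ a `* b ⟧ ρ = ⟦ a ⟧ ρ * ⟦ b ⟧ ρ

  ⟦^⟧ : ∀ {n} (e : Expr n) k ρ → ⟦ e `^ k ⟧ ρ ≈ ⟦ e ⟧ ρ ^ k
  ⟦^⟧ e zero    ρ = refl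
  ⟦^⟧ e (suc k) ρ = *-congˡ (⟦^⟧ e k ρ)

  -- c₀ + c₁ z + … + c_{d-1} z^{d-1} + b z^d: the leading coefficient b is kept apart, so
  -- that b = 1 gives the monic polynomials of degree d and b = 0 the polynomials of degree < d.
  eval : ∀ {d} → Carrier → Vec Carrier d → Carrier → Carrier
  eval b []       z = b
  eval b (c ∷ cs) z = c + z * eval b cs z

  -- Synthetic division by z - x: the coefficients are the intermediate values of Horner's scheme at
  -- x. The leading coefficient 1 stays implicit on both sides.
  quotient : ∀ {d} → Carrier → Vec Carrier (suc d) → Vec Carrier d
  quotient x (c ∷ [])          = []
  quotient x (c ∷ cs@(_ ∷ _)) = eval 1# cs x ∷ quotient x cs

  -- h(z) - h(x) = (z - x) h′(z), without subtraction.
  quotient-spec : ∀ {d} (h : Vec Carrier (suc d)) x z →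
    eval 1# h z + x * eval 1# (quotient x h) z ≈ eval 1# h x + z * eval 1# (quotient x h) z
  quotient-spec (c ∷ []) x z =
    solve 3 (λ c x z → (c :+ z :* con 1) :+ x :* con 1 := (c :+ x :* con 1) :+ z :* con 1) refl c x z
  quotient-spec (c ∷ cs@(_ ∷ _)) x z = begin
    (c + z * hz) + x * (hx + z * kz)
      ≈⟨ solve 6 (λ c x z hz hx kz → (c :+ z :* hz) :+ x :* (hx :+ z :* kz)
           := (c :+ x :* hx) :+ z :* (hz :+ x :* kz)) refl c x z hz hx kz ⟩
    (c + x * hx) + z * (hz + x * kz)
      ≈⟨ +-congˡ (*-congˡ (quotient-spec cs x z)) ⟩
    (c + x * hx) + z * (hx + z * kz) ∎
    where
    hz = eval 1# cs z
    hx = eval 1# cs x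
    kz = eval 1# (quotient x cs) z

  -- One root splits off a linear factor, and the other points, being different from it, remain
  -- roots of the quotient. Monicity is preserved, so the process ends at the constant 1, which has
  -- no root.
  roots≤degree : ∀ {k d} (h : Vec Carrier d) (y : Fin k → Carrier) → (∀ i j → y i ≈ y j → i ≡ j) →
                 (∀ i → eval 1# h (y i) ≈ 0#) → k ℕ.≤ d
  roots≤degree {zero}  h        y y-inj root = z≤n
  roots≤degree {suc k} []       y y-inj root = contradiction (root zero) 1≉0
  roots≤degree {suc k} h@(_ ∷ _) y y-inj root =
    s≤s (roots≤degree (quotient y₀ h) (y ∘ suc) (λ i j e → Fin.suc-injective (y-inj (suc i) (suc j) e)) root′)
    where
    y₀ = y zero
    root′ : ∀ i → eval 1# (quotient y₀ h) (y (suc i)) ≈ 0#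
    root′ i = ≉-cancel {a = y₀} {b = y (suc i)} (λ e → case-≢ (y-inj zero (suc i) e)) (begin
      y₀ * w                              ≈⟨ +-identityˡ _ ⟨
      0# + y₀ * w                         ≈⟨ +-congʳ (root (suc i)) ⟨
      eval 1# h (y (suc i)) + y₀ * w      ≈⟨ quotient-spec h y₀ (y (suc i)) ⟩
      eval 1# h y₀ + y (suc i) * w        ≈⟨ +-congʳ (root zero) ⟩
      0# + y (suc i) * w                  ≈⟨ +-identityˡ _ ⟩
      y (suc i) * w                       ∎)
      where
      w = eval 1# (quotient y₀ h) (y (suc i))
      case-≢ : ∀ {k} {j : Fin k} → Fin.zero ≡ suc j → _
      case-≢ ()

  poly : ∀ {n d} → (Fin n → Carrier) → Carrier → Vec (Expr n) d → Carrier → Carrier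
  poly ρ b cs = eval b (Vec.map (λ e → ⟦ e ⟧ ρ) cs)

  poly-cong : ∀ {n d b b′} (ρ : Fin n → Carrier) (cs : Vec (Expr n) d) z → b ≈ b′ → poly ρ b cs z ≈ poly ρ b′ cs z
  poly-cong ρ []       z b≈b′ = b≈b′
  poly-cong ρ (c ∷ cs) z b≈b′ = +-congˡ (*-congˡ (poly-cong ρ cs z b≈b′))

  poly-zeros : ∀ {n} (ρ : Fin n → Carrier) b d z → poly ρ b (Vec.replicate d `0) z ≈ z ^ d * b
  poly-zeros ρ b zero    z = sym (*-identityˡ b)
  poly-zeros ρ b (suc d) z = begin
    0# + z * poly ρ b (Vec.replicate d `0) z  ≈⟨ +-identityˡ _ ⟩
    z * poly ρ b (Vec.replicate d `0) z       ≈⟨ *-congˡ (poly-zeros ρ b d z) ⟩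
    z * (z ^ d * b)                           ≈⟨ *-assoc z (z ^ d) b ⟨
    z ^ suc d * b                             ∎

  frobenius-vanishes : ∀ {n} Q (ρ : Fin n → Carrier) x → x ^ suc (suc Q) ≈ x → poly ρ 1# (frobenius Q) x ≈ 0#
  frobenius-vanishes Q ρ x fermat = begin
    0# + x * (- 1# + x * poly ρ 1# (Vec.replicate Q `0) x)
      ≈⟨ +-congˡ (*-congˡ (+-congˡ (*-congˡ (poly-zeros ρ 1# Q x)))) ⟩
    0# + x * (- 1# + x * (x ^ Q * 1#))
      ≈⟨ solve 3 (λ x N P → con 0 :+ x :* (N :+ x :* (P :* con 1)) := x :* (x :* P) :+ N :* x)
           refl x (- 1#) (x ^ Q) ⟩
    x ^ suc (suc Q) + (- 1#) * x  ≈⟨ +-congʳ fermat ⟩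
    x + (- 1#) * x                ≈⟨ x+-1*x≈0 x ⟩
    0#                            ∎

  -- Padding gives a coefficient list of any length k the length k + d that `divide` expects.
  poly-pad : ∀ {n k} (ρ : Fin n → Carrier) (cs : Vec (Expr n) k) d z →
             poly ρ 0# (cs Vec.++ Vec.replicate d `0) z ≈ poly ρ 0# cs z
  poly-pad ρ []       d z = trans (poly-zeros ρ 0# d z) (zeroʳ _)
  poly-pad ρ (c ∷ cs) d z = +-congˡ (*-congˡ (poly-pad ρ cs d z))

  poly-scale : ∀ {n d} (ρ : Fin n → Carrier) u t (cs : Vec (Expr n) d) z →
               poly ρ (⟦ u ⟧ ρ * t) (Vec.map (u `*_) cs) z ≈ ⟦ u ⟧ ρ * poly ρ t cs z
  poly-scale ρ u t []       z = refl
  poly-scale ρ u t (c ∷ cs) z = trans (+-congˡ (*-congˡ (poly-scale ρ u t cs z)))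
    (solve 4 (λ U C z P → U :* C :+ z :* (U :* P) := U :* (C :+ z :* P)) refl (⟦ u ⟧ ρ) (⟦ c ⟧ ρ) z (poly ρ t cs z))

-- Expressions as polynomials in one generator, and division with remainder

Polynomial : ℕ → Set
Polynomial n = List (Expr n)

_⊞_ : ∀ {n} → Polynomial n → Polynomial n → Polynomial n
[]       ⊞ ys       = ys
(x ∷ xs) ⊞ []       = x ∷ xs
(x ∷ xs) ⊞ (y ∷ ys) = (x `+ y) ∷ (xs ⊞ ys)

_⊠_ : ∀ {n} → Polynomial n → Polynomial n → Polynomial n
[]       ⊠ ys = []
(x ∷ xs) ⊠ ys = List.map (x `*_) ys ⊞ (`0 ∷ (xs ⊠ ys))

-- Sorts an expression by powers of the newest generator, `gen zero`, with coefficients in the older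
-- ones: elements of R[α] become polynomials in α over R.
toPolynomial : ∀ {n} → Expr (suc n) → Polynomial n
toPolynomial `0            = []
toPolynomial `1            = `1 ∷ []
toPolynomial `-1           = `-1 ∷ []
toPolynomial (gen zero)    = `0 ∷ `1 ∷ []
toPolynomial (gen (suc i)) = gen i ∷ []
toPolynomial (a `+ b)      = toPolynomial a ⊞ toPolynomial b
toPolynomial (a `* b)      = toPolynomial a ⊠ toPolynomial b

module PolynomialEvaluation (L : Field) {n} (ρ : Fin n → Field.Carrier L) (z : Field.Carrier L) where
  open Field L hiding (zero)
  open FieldProperties L
  open Evaluation L
  open SetoidReasoning setoid

  ⟪_⟫ : Polynomial n → Carrier
  ⟪ xs ⟫ = poly ρ 0# (Vec.fromList xs) z

  ⊞-homo : ∀ xs ys → ⟪ xs ⊞ ys ⟫ ≈ ⟪ xs ⟫ + ⟪ ys ⟫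
  ⊞-homo []       ys       = sym (+-identityˡ _)
  ⊞-homo (x ∷ xs) []       = sym (+-identityʳ _)
  ⊞-homo (x ∷ xs) (y ∷ ys) = trans (+-congˡ (*-congˡ (⊞-homo xs ys)))
    (solve 5 (λ x y z X Y → (x :+ y) :+ z :* (X :+ Y) := (x :+ z :* X) :+ (y :+ z :* Y)) refl
      (⟦ x ⟧ ρ) (⟦ y ⟧ ρ) z ⟪ xs ⟫ ⟪ ys ⟫)

  scale-homo : ∀ x ys → ⟪ List.map (x `*_) ys ⟫ ≈ ⟦ x ⟧ ρ * ⟪ ys ⟫
  scale-homo x []       = sym (zeroʳ _)
  scale-homo x (y ∷ ys) = trans (+-congˡ (*-congˡ (scale-homo x ys)))
    (solve 4 (λ x y z Y → x :* y :+ z :* (x :* Y) := x :* (y :+ z :* Y)) refl (⟦ x ⟧ ρ) (⟦ y ⟧ ρ) z ⟪ ys ⟫)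

  ⊠-homo : ∀ xs ys → ⟪ xs ⊠ ys ⟫ ≈ ⟪ xs ⟫ * ⟪ ys ⟫
  ⊠-homo []       ys = sym (zeroˡ _)
  ⊠-homo (x ∷ xs) ys = begin
    ⟪ List.map (x `*_) ys ⊞ (`0 ∷ (xs ⊠ ys)) ⟫       ≈⟨ ⊞-homo (List.map (x `*_) ys) (`0 ∷ (xs ⊠ ys)) ⟩
    ⟪ List.map (x `*_) ys ⟫ + (0# + z * ⟪ xs ⊠ ys ⟫)  ≈⟨ +-cong (scale-homo x ys) (+-congˡ (*-congˡ (⊠-homo xs ys))) ⟩
    ⟦ x ⟧ ρ * ⟪ ys ⟫ + (0# + z * (⟪ xs ⟫ * ⟪ ys ⟫))
      ≈⟨ solve 4 (λ x z X Y → x :* Y :+ (con 0 :+ z :* (X :* Y)) := (x :+ z :* X) :* Y) refl (⟦ x ⟧ ρ) z ⟪ xs ⟫ ⟪ ys ⟫ ⟩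
    (⟦ x ⟧ ρ + z * ⟪ xs ⟫) * ⟪ ys ⟫                   ∎

  constant : ∀ c → c ≈ c + z * 0#
  constant c = solve 2 (λ c z → c := c :+ z :* con 0) refl c z

-- Passes from "degree at most d, leading coefficient among the entries" to the encoding of `poly`,
-- where it stands apart.
topCoefficient : ∀ {n d} → Vec (Expr n) (suc d) → Expr n × Vec (Expr n) d
topCoefficient (c ∷ [])         = c , []
topCoefficient (c ∷ cs@(_ ∷ _)) = let t , i = topCoefficient cs in t , c ∷ i

-- (t X^d + g) - t (X^d + f)
reduce : ∀ {n d} → Expr n → Vec (Expr n) d → Vec (Expr n) d → Vec (Expr n) d
reduce t = Vec.zipWith (λ a b → b `+ `-1 `* (t `* a))

-- Quotient (without its leading coefficient t) and remainder of t X^{k+d} + g by the monic X^d + f.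
divide : ∀ {n k d} → Expr n → Vec (Expr n) d → Vec (Expr n) (k ℕ.+ d) → Vec (Expr n) k × Vec (Expr n) d
divide {k = zero}  t f g       = [] , reduce t f g
divide {k = suc k} t f (c ∷ g) =
  let h , r = divide t f g
      u , i = topCoefficient (c ∷ r)
  in u ∷ h , reduce u f i

module PolynomialArithmetic (L : Field) where
  open Field L hiding (zero)
  open FieldProperties L
  open Evaluation L
  open SetoidReasoning setoid

  toPolynomial-spec : ∀ {n} (e : Expr (suc n)) (ρ : Fin (suc n) → Carrier) →
    ⟦ e ⟧ ρ ≈ poly (ρ ∘ suc) 0# (Vec.fromList (toPolynomial e)) (ρ zero)
  toPolynomial-spec e ρ = go e
    where
    open PolynomialEvaluation L (ρ ∘ suc) (ρ zero)
    go : ∀ e → ⟦ e ⟧ ρ ≈ ⟪ toPolynomial e ⟫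
    go `0            = refl
    go `1            = constant _
    go `-1           = constant _
    go (gen zero)    = solve 1 (λ z → z := con 0 :+ z :* (con 1 :+ z :* con 0)) refl (ρ zero)
    go (gen (suc i)) = constant _
    go (a `+ b)      = trans (+-cong (go a) (go b)) (sym (⊞-homo (toPolynomial a) (toPolynomial b)))
    go (a `* b)      = trans (*-cong (go a) (go b)) (sym (⊠-homo (toPolynomial a) (toPolynomial b)))

  module _ {n} (ρ : Fin n → Carrier) (z : Carrier) where

    topCoefficient-spec : ∀ {d} (s : Vec (Expr n) (suc d)) →
      poly ρ 0# s z ≈ poly ρ (⟦ proj₁ (topCoefficient s) ⟧ ρ) (proj₂ (topCoefficient s)) z
    topCoefficient-spec (c ∷ [])         = solve 2 (λ c z → c :+ z :* con 0 := c) refl (⟦ c ⟧ ρ) z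
    topCoefficient-spec (c ∷ cs@(_ ∷ _)) = +-congˡ (*-congˡ (topCoefficient-spec cs))

    reduce-spec : ∀ {d} t (f g : Vec (Expr n) d) →
      poly ρ (⟦ t ⟧ ρ) g z ≈ ⟦ t ⟧ ρ * poly ρ 1# f z + poly ρ 0# (reduce t f g) z
    reduce-spec t []      []      = solve 1 (λ t → t := t :* con 1 :+ con 0) refl (⟦ t ⟧ ρ)
    reduce-spec t (a ∷ f) (b ∷ g) = begin
      B + z * poly ρ T g z                         ≈⟨ +-congˡ (*-congˡ (reduce-spec t f g)) ⟩
      -- The solver knows semirings only and treats -1 as an atom, so the cancelling pair T A - T A
      -- is inserted by hand.
      B + z * (T * F + R)                          ≈⟨ +-identityʳ _ ⟨
      B + z * (T * F + R) + 0#                     ≈⟨ +-congˡ (x+-1*x≈0 (T * A)) ⟨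
      B + z * (T * F + R) + (T * A + N * (T * A))
        ≈⟨ solve 7 (λ B z T F R A N → B :+ z :* (T :* F :+ R) :+ (T :* A :+ N :* (T :* A))
             := T :* (A :+ z :* F) :+ (B :+ N :* (T :* A) :+ z :* R)) refl B z T F R A N ⟩
      T * (A + z * F) + (B + N * (T * A) + z * R)  ∎
      where
      T = ⟦ t ⟧ ρ
      A = ⟦ a ⟧ ρ
      B = ⟦ b ⟧ ρ
      N = - 1#
      F = poly ρ 1# f z
      R = poly ρ 0# (reduce t f g) z

    -- Induction on k after factoring X out of everything but the constant term c: the new remainder
    -- X r + c can reach degree d, so it is reduced once more, and its top coefficient becomes the
    -- constant term of the quotient.
    divide-spec : ∀ {k d} t (f : Vec (Expr n) d) (g : Vec (Expr n) (k ℕ.+ d)) →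
      poly ρ (⟦ t ⟧ ρ) g z ≈ poly ρ 1# f z * poly ρ (⟦ t ⟧ ρ) (proj₁ (divide {k = k} t f g)) z
                             + poly ρ 0# (proj₂ (divide {k = k} t f g)) z
    divide-spec {zero}  t f g       = trans (reduce-spec t f g) (+-congʳ (*-comm _ _))
    divide-spec {suc k} t f (c ∷ g) = begin
      C + z * poly ρ (⟦ t ⟧ ρ) g z  ≈⟨ +-congˡ (*-congˡ (divide-spec {k} t f g)) ⟩
      C + z * (F * H + R)
        ≈⟨ solve 5 (λ C z F H R → C :+ z :* (F :* H :+ R) := (C :+ z :* R) :+ F :* (z :* H)) refl C z F H R ⟩
      (C + z * R) + F * (z * H)     ≈⟨ +-congʳ (trans (topCoefficient-spec (c ∷ r)) (reduce-spec u f i)) ⟩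
      (U * F + R′) + F * (z * H)
        ≈⟨ solve 5 (λ U F R z H → (U :* F :+ R) :+ F :* (z :* H) := F :* (U :+ z :* H) :+ R) refl U F R′ z H ⟩
      F * (U + z * H) + R′          ∎
      where
      r = proj₂ (divide {k = k} t f g)
      u = proj₁ (topCoefficient (c ∷ r))
      i = proj₂ (topCoefficient (c ∷ r))
      C = ⟦ c ⟧ ρ
      U = ⟦ u ⟧ ρ
      F = poly ρ 1# f z
      H = poly ρ (⟦ t ⟧ ρ) (proj₁ (divide {k = k} t f g)) z
      R = poly ρ 0# r z
      R′ = poly ρ 0# (reduce u f i) z

    remainder-at-root : ∀ {k d} t (f : Vec (Expr n) d) (g : Vec (Expr n) (k ℕ.+ d)) → poly ρ 1# f z ≈ 0# →
      poly ρ (⟦ t ⟧ ρ) g z ≈ poly ρ 0# (proj₂ (divide {k = k} t f g)) z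
    remainder-at-root {k} t f g f≈0 =
      trans (divide-spec {k} t f g) (trans (+-congʳ (trans (*-congʳ f≈0) (zeroˡ _))) (+-identityˡ _))

-- Extending a homomorphism by one element

-- The theorem's conclusions are decidable inequalities, so its proof may live in the double negation monad.
_>>=_ : ∀ {a b} {A : Set a} {B : Set b} → ¬ ¬ A → (A → ¬ ¬ B) → ¬ ¬ B
(m >>= f) ¬b = m λ a → f a ¬b

return : ∀ {a} {A : Set a} → A → ¬ ¬ A
return a ¬a = ¬a a

Least : (ℕ → Set) → ℕ → Set
Least P d = P d × (∀ e → e ℕ.< d → ¬ P e)

least : ∀ (P : ℕ → Set) N → P N → ¬ ¬ (∃ λ d → d ℕ.≤ N × Least P d)
least P N PN = do
  inj₁ (d , d<1+N , m) ← search (suc N)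
    where inj₂ none → contradiction PN (none N ℕ.≤-refl)
  return (d , ℕ.s≤s⁻¹ d<1+N , m)
  where
  search : ∀ N → ¬ ¬ ((∃ λ d → d ℕ.< N × Least P d) ⊎ (∀ d → d ℕ.< N → ¬ P d))
  search zero    = return (inj₂ λ _ ())
  search (suc N) = do
    inj₂ none ← search N
      where inj₁ (d , d<N , m) → return (inj₁ (d , ℕ.m<n⇒m<1+n d<N , m))
    no ¬PN ← ¬¬-excluded-middle {A = P N}
      where yes PN → return (inj₁ (N , ℕ.≤-refl , PN , none))
    return (inj₂ λ d d<1+N Pd → case ℕ.m≤n⇒m<n∨m≡n (ℕ.s≤s⁻¹ d<1+N) of λ
      { (inj₁ d<N) → none d d<N Pd
      ; (inj₂ d≡N) → ¬PN (≡.subst P d≡N Pd) })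

module _ (F K : Field) where
  private
    module F = Field F
    module K = Field K

  -- Then ⟦ e ⟧ ρ ↦ ⟦ e ⟧ ρ′ is a well defined homomorphism on the subring generated by ρ.
  Compatible : ∀ {n} → (Fin n → F.Carrier) → (Fin n → K.Carrier) → Set
  Compatible ρ ρ′ = ∀ e → Evaluation.⟦_⟧ F e ρ F.≈ F.0# → Evaluation.⟦_⟧ K e ρ′ K.≈ K.0#

-- With |K| of the form `suc (suc Q)`, the coefficients of X^|K| - X are a literal list, and Q = |K|
-- - 2 is the exponent that inverts nonzero elements.
module Extension (F K : Field) (q Q : ℕ) (cardF : HasCard F q) (cardK : HasCard K (suc (suc Q)))
                 (fermatF : ∀ x → Field._≈_ F (FieldProperties._^_ F x (suc (suc Q))) x) where
  private
    module F where
      open Field F hiding (zero) public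
      open FieldProperties F public
      open Evaluation F public
      open PolynomialArithmetic F public
      open FiniteField F q cardF public using (_≟_)
    module K where
      open Field K hiding (zero) public
      open FieldProperties K public
      open Evaluation K public
      open PolynomialArithmetic K public
      open FiniteField K (suc (suc Q)) cardK public
    N : ℕ
    N = suc (suc Q)

  module _ {n} (ρ₀ : Fin (suc n) → F.Carrier) (ρ′ : Fin n → K.Carrier) (compatible : Compatible F K (ρ₀ ∘ suc) ρ′) where
    private
      α : F.Carrier
      α = ρ₀ zero
      ρ : Fin n → F.Carrier
      ρ = ρ₀ ∘ suc

    -- The least such d is the degree of the minimal polynomial of α over R. The degree N is always
    -- possible, by `frobenius Q`.
    MonicRelation : ℕ → Set
    MonicRelation d = ∃ λ (f : Vec (Expr n) d) → F.poly ρ F.1# f α F.≈ F.0#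

    -- Normalising a polynomial over R must not leave R, so the inverse of t has to be an expression
    -- in the same generators; t^(N-2) is one.
    inverse-expr : ∀ t → ¬ F.⟦ t ⟧ ρ F.≈ F.0# → F.⟦ t `^ Q ⟧ ρ F.* F.⟦ t ⟧ ρ F.≈ F.1#
    inverse-expr t t≉0 = F.*-cancelʳ-≉0 t≉0 (begin
      (F.⟦ t `^ Q ⟧ ρ F.* T) F.* T  ≈⟨ F.*-congʳ (F.*-congʳ (F.⟦^⟧ t Q ρ)) ⟩
      ((T F.^ Q) F.* T) F.* T       ≈⟨ F.solve 2 (λ P T → (P F.:* T) F.:* T F.:= T F.:* (T F.:* P)) F.refl (T F.^ Q) T ⟩
      T F.^ N                       ≈⟨ fermatF T ⟩
      T                             ≈⟨ F.*-identityˡ T ⟨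
      F.1# F.* T                    ∎)
      where
      open SetoidReasoning F.setoid
      T = F.⟦ t ⟧ ρ

    relation-of-small-degree : ∀ {d} → (∀ e → e ℕ.< d → ¬ MonicRelation e) →
      ∀ {l} → l ℕ.≤ d → (r : Vec (Expr n) l) → F.poly ρ F.0# r α F.≈ F.0# → ∀ y → K.poly ρ′ K.0# r y K.≈ K.0#
    relation-of-small-degree minimal {zero}  l≤d [] r≈0 y = K.refl
    relation-of-small-degree minimal {suc l} l<d r  r≈0 y
      with topCoefficient r | F.topCoefficient-spec ρ α r | K.topCoefficient-spec ρ′ y r
    ... | t , i | r≈tiF | r≈tiK with F.⟦ t ⟧ ρ F.≟ F.0#
    ... | yes t≈0 = begin
      K.poly ρ′ K.0# r y         ≈⟨ r≈tiK ⟩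
      K.poly ρ′ (K.⟦ t ⟧ ρ′) i y  ≈⟨ K.poly-cong ρ′ i y (compatible t t≈0) ⟩
      K.poly ρ′ K.0# i y         ≈⟨ relation-of-small-degree minimal (ℕ.<⇒≤ l<d) i i≈0 y ⟩
      K.0#                       ∎
      where
      open SetoidReasoning K.setoid
      i≈0 : F.poly ρ F.0# i α F.≈ F.0#
      i≈0 = F.trans (F.poly-cong ρ i α (F.sym t≈0)) (F.trans (F.sym r≈tiF) r≈0)
    ... | no t≉0 = contradiction (Vec.map (u `*_) i , monic) (minimal l l<d)
      where
      open SetoidReasoning F.setoid
      u = t `^ Q
      monic : F.poly ρ F.1# (Vec.map (u `*_) i) α F.≈ F.0#
      monic = begin
        F.poly ρ F.1# (Vec.map (u `*_) i) α                           ≈⟨ F.poly-cong ρ (Vec.map (u `*_) i) α (inverse-expr t t≉0) ⟨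
        F.poly ρ (F.⟦ u ⟧ ρ F.* F.⟦ t ⟧ ρ) (Vec.map (u `*_) i) α      ≈⟨ F.poly-scale ρ u (F.⟦ t ⟧ ρ) i α ⟩
        F.⟦ u ⟧ ρ F.* F.poly ρ (F.⟦ t ⟧ ρ) i α                        ≈⟨ F.*-congˡ (F.trans (F.sym r≈tiF) r≈0) ⟩
        F.⟦ u ⟧ ρ F.* F.0#                                            ≈⟨ F.zeroʳ _ ⟩
        F.0#                                                          ∎

    -- Ensures that the cofactor of f in X^N - X has degree below N and therefore fewer than N
    -- roots.
    positive-degree : ∀ {d} → MonicRelation d → 0 ℕ.< d
    positive-degree {zero}  ([] , 1≈0) = contradiction 1≈0 F.1≉0
    positive-degree {suc d} _          = s≤s z≤n

    minimal-relation-has-root : ∀ {d} → d ℕ.≤ N → (m : Least MonicRelation d) →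
      ∃ λ a → K.poly ρ′ K.1# (proj₁ (proj₁ m)) a K.≈ K.0#
    minimal-relation-has-root {d} d≤N m@((f , fα≈0) , minimal) =
      -- `frobenius Q` has length N, which is k + d only up to a proof; the free length e in `root`
      -- lets a match on that proof retype the polynomial for `divide`.
      root (N ∸ d) N≡k+d N≡k+d (frobenius Q) (F.frobenius-vanishes Q ρ α (fermatF α))
           (λ y → K.frobenius-vanishes Q ρ′ y (K.fermat y))
      where
      N≡k+d : N ≡ (N ∸ d) ℕ.+ d
      N≡k+d = ≡.sym (ℕ.m∸n+n≡m d≤N)

      -- Without a root of f all N elements of K would be roots of the cofactor of f in X^N - X.
      root : ∀ k {e} → N ≡ k ℕ.+ d → e ≡ k ℕ.+ d → (g : Vec (Expr n) e) → F.poly ρ F.1# g α F.≈ F.0# →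
             (∀ y → K.poly ρ′ K.1# g y K.≈ K.0#) → ∃ λ a → K.poly ρ′ K.1# f a K.≈ K.0#
      root k N≡k+d ≡.refl g gα≈0 g≈0 with Fin.any? (λ i → K.poly ρ′ K.1# f (K.elt i) K.≟ K.0#)
      ... | yes (i , fi≈0) = K.elt i , fi≈0
      ... | no no-root = contradiction
        (K.roots≤degree (Vec.map (λ e → K.⟦ e ⟧ ρ′) h) K.elt K.elt-injective h≈0)
        (ℕ.<⇒≱ (≡.subst (k ℕ.<_) (≡.sym N≡k+d) (ℕ.m<m+n k (positive-degree (proj₁ m)))))
        where
        h = proj₁ (divide {k = k} `1 f g)
        r = proj₂ (divide {k = k} `1 f g)

        r≈0 : ∀ y → K.poly ρ′ K.0# r y K.≈ K.0#
        r≈0 = relation-of-small-degree minimal ℕ.≤-refl r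
          (F.trans (F.sym (F.remainder-at-root ρ α {k} `1 f g fα≈0)) gα≈0)

        h≈0 : ∀ i → K.poly ρ′ K.1# h (K.elt i) K.≈ K.0#
        h≈0 i = K.no-zero-divisors (λ e → no-root (i , e)) (begin
          K.poly ρ′ K.1# f y K.* K.poly ρ′ K.1# h y                         ≈⟨ K.+-identityʳ _ ⟨
          K.poly ρ′ K.1# f y K.* K.poly ρ′ K.1# h y K.+ K.0#                ≈⟨ K.+-congˡ (r≈0 y) ⟨
          K.poly ρ′ K.1# f y K.* K.poly ρ′ K.1# h y K.+ K.poly ρ′ K.0# r y  ≈⟨ K.divide-spec ρ′ y {k} `1 f g ⟨
          K.poly ρ′ K.1# g y                                                ≈⟨ g≈0 y ⟩
          K.0#                                                              ∎)
          where
          open SetoidReasoning K.setoid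
          y = K.elt i

    -- Let e, read as a polynomial in α, vanish at α. Its remainder modulo f vanishes at α too and
    -- has degree below d, so it vanishes over K at a. Since f(a) = 0, the value of e at a equals
    -- that of the remainder.
    extend-by-root : ∀ {d} (m : Least MonicRelation d) a → K.poly ρ′ K.1# (proj₁ (proj₁ m)) a K.≈ K.0# →
      Compatible F K ρ₀ (a VecF.∷ ρ′)
    extend-by-root {d} ((f , fα≈0) , minimal) a fa≈0 e eα≈0 = begin
      K.⟦ e ⟧ (a VecF.∷ ρ′)   ≈⟨ K.toPolynomial-spec e (a VecF.∷ ρ′) ⟩
      K.poly ρ′ K.0# g a      ≈⟨ K.poly-pad ρ′ g d a ⟨
      K.poly ρ′ K.0# g₊ a     ≈⟨ K.remainder-at-root ρ′ a {k} `0 f g₊ fa≈0 ⟩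
      K.poly ρ′ K.0# r a      ≈⟨ relation-of-small-degree minimal ℕ.≤-refl r rα≈0 a ⟩
      K.0#                    ∎
      where
      k = List.length (toPolynomial e)
      g = Vec.fromList (toPolynomial e)
      -- The top coefficient handed to `divide` is `0`, because all coefficients of e already occur
      -- in g.
      g₊ = g Vec.++ Vec.replicate d `0
      r = proj₂ (divide {k = k} `0 f g₊)
      rα≈0 : F.poly ρ F.0# r α F.≈ F.0#
      rα≈0 = begin
        F.poly ρ F.0# r α   ≈⟨ F.remainder-at-root ρ α {k} `0 f g₊ fα≈0 ⟨
        F.poly ρ F.0# g₊ α  ≈⟨ F.poly-pad ρ g d α ⟩
        F.poly ρ F.0# g α   ≈⟨ F.toPolynomial-spec e ρ₀ ⟨
        F.⟦ e ⟧ ρ₀          ≈⟨ eα≈0 ⟩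
        F.0#                ∎
        where open SetoidReasoning F.setoid
      open SetoidReasoning K.setoid

    extend : ¬ ¬ (∃ λ a → Compatible F K ρ₀ (a VecF.∷ ρ′))
    extend = do
      d , d≤N , m ← least MonicRelation N (frobenius Q , F.frobenius-vanishes Q ρ α (fermatF α))
      let a , fa≈0 = minimal-relation-has-root d≤N m
      return (a , extend-by-root m a fa≈0)

-- Embedding F into K; bases of K over F

-- Without generators only the prime field is reached. Reading -1 as p - 1 turns a closed expression
-- into a multiple of 1 in every field where p × 1 = 0.
natural : ℕ → Expr 0 → ℕ
natural p `0       = 0
natural p `1       = 1
natural p `-1      = ℕ.pred p
natural p (a `+ b) = natural p a ℕ.+ natural p b
natural p (a `* b) = natural p a ℕ.* natural p b

module Characteristic (L : Field) (p : ℕ) (p×1≈0 : Field._≈_ L (FieldProperties._×ₙ_ L p (Field.1# L)) (Field.0# L)) where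
  open Field L
  open FieldProperties L
  open Evaluation L

  natural-spec : .{{ℕ.NonZero p}} → ∀ e ρ → ⟦ e ⟧ ρ ≈ natural p e ×ₙ 1#
  natural-spec `0       ρ = refl
  natural-spec `1       ρ = sym (×-homo-1 1#)
  natural-spec `-1      ρ = sym (+-inverseʳ-unique 1# _ (≡.subst (λ n → n ×ₙ 1# ≈ 0#) (≡.sym (ℕ.suc-pred p)) p×1≈0))
  natural-spec (a `+ b) ρ =
    trans (+-cong (natural-spec a ρ) (natural-spec b ρ)) (sym (×-homo-+ 1# (natural p a) (natural p b)))
  natural-spec (a `* b) ρ =
    trans (*-cong (natural-spec a ρ) (natural-spec b ρ)) (sym (×1-homo-* (natural p a) (natural p b)))

  *×1≈0 : ∀ k {n} → n ×ₙ 1# ≈ 0# → (k ℕ.* n) ×ₙ 1# ≈ 0#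
  *×1≈0 k {n} n×1≈0 = trans (×1-homo-* k n) (trans (*-congˡ n×1≈0) (zeroʳ _))

  ×1≈0⇒∣ : Prime p → ∀ n → n ×ₙ 1# ≈ 0# → p ∣ n
  ×1≈0⇒∣ p-prime n n×1≈0 with p ∣? n
  ... | yes p∣n = p∣n
  -- Bézout's identity presents 1 as a difference of multiples of p and n, both of which annihilate
  -- 1#.
  ... | no p∤n = contradiction (bezout (coprime-Bézout coprime)) 1≉0
    where
    coprime : Coprime p n
    coprime (d∣p , d∣n) with prime⇒irreducible p-prime d∣p
    ... | inj₁ d≡1    = d≡1
    ... | inj₂ ≡.refl = contradiction d∣n p∤n
    1≈0 : ∀ {a b} → 1 ℕ.+ a ≡ b → a ×ₙ 1# ≈ 0# → b ×ₙ 1# ≈ 0# → 1# ≈ 0#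
    1≈0 ≡.refl a≈0 b≈0 = trans (sym (+-identityʳ 1#)) (trans (+-congˡ (sym a≈0)) b≈0)
    bezout : Bézout.Identity 1 p n → 1# ≈ 0#
    bezout (Bézout.+- x y eq) = 1≈0 eq (*×1≈0 y n×1≈0) (*×1≈0 x p×1≈0)
    bezout (Bézout.-+ x y eq) = 1≈0 eq (*×1≈0 x p×1≈0) (*×1≈0 y n×1≈0)

record Embedding (F K : Field) : Set where
  private
    module F = Field F
    module K = Field K
  field
    σ      : F.Carrier → K.Carrier
    σ-cong : ∀ {x y} → x F.≈ y → σ x K.≈ σ y
    +-homo : ∀ x y → σ (x F.+ y) K.≈ σ x K.+ σ y
    *-homo : ∀ x y → σ (x F.* y) K.≈ σ x K.* σ y
    0-homo : σ F.0# K.≈ K.0#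
    1-homo : σ F.1# K.≈ K.1#

  σ-1 : ∀ x → x K.+ σ (F.- F.1#) K.* x K.≈ K.0#
  σ-1 x = begin
    x K.+ σ (F.- F.1#) K.* x            ≈⟨ K.+-congʳ (K.trans (K.*-congʳ 1-homo) (K.*-identityˡ x)) ⟨
    σ F.1# K.* x K.+ σ (F.- F.1#) K.* x ≈⟨ K.distribʳ x _ _ ⟨
    (σ F.1# K.+ σ (F.- F.1#)) K.* x     ≈⟨ K.*-congʳ (+-homo F.1# (F.- F.1#)) ⟨
    σ (F.1# F.- F.1#) K.* x             ≈⟨ K.*-congʳ (K.trans (σ-cong (F.-‿inverseʳ F.1#)) 0-homo) ⟩
    K.0# K.* x                          ≈⟨ K.zeroˡ x ⟩
    K.0#                                ∎
    where open SetoidReasoning K.setoid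

module _ {q m : ℕ} (isPrimePower : IsPrimePower q)
         (F K : Field) (cardF : HasCard F q) (cardK : HasCard K (q ℕ.^ m)) where
  private
    module F where
      open Field F public hiding (zero)
      open FieldProperties F public
      open Evaluation F public
      open FiniteField F q cardF public
    module K where
      open Field K public hiding (zero)
      open FieldProperties K public
      open Evaluation K public
      open FiniteField K (q ℕ.^ m) cardK public

  -- Induction on the number of generators. In the base case p is the characteristic of both fields,
  -- as |K| = p^(k m): a closed expression that vanishes in F stands for a multiple of p and so
  -- vanishes in K.
  compatible-extension : ∀ {n} (ρ : Fin n → F.Carrier) → ¬ ¬ (∃ λ ρ′ → Compatible F K ρ ρ′)
  compatible-extension {zero}  ρ = return (VecF.[] , compatible isPrimePower)
    where
    compatible : IsPrimePower q → Compatible F K ρ VecF.[]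
    compatible (p , k , p-prime , _ , q≡p^k) e e≈0
      with CharF.×1≈0⇒∣ p-prime (natural p e) (F.trans (F.sym (CharF.natural-spec {{prime⇒nonZero p-prime}} e ρ)) e≈0)
      where module CharF = Characteristic F p (F.p×1≈0 k q≡p^k)
    ... | divides c eq = K.trans (CharK.natural-spec {{prime⇒nonZero p-prime}} e VecF.[])
        (≡.subst (λ n → n K.×ₙ K.1# K.≈ K.0#) (≡.sym eq) (CharK.*×1≈0 c pK≈0))
      where
      pK≈0 : p K.×ₙ K.1# K.≈ K.0#
      pK≈0 = K.p×1≈0 (k ℕ.* m) (≡.trans (≡.cong (ℕ._^ m) q≡p^k) (ℕ.^-*-assoc p k m))
      module CharK = Characteristic K p pK≈0
  compatible-extension {suc n} ρ = do
    ρ′ , compatible ← compatible-extension (ρ ∘ suc)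
    a , compatible′ ← step ≡.refl ρ′ compatible
    return (a VecF.∷ ρ′ , compatible′)
    where
    1<q^m : ∀ {Q} → q ℕ.^ m ≡ Q → 1 ℕ.< Q
    1<q^m ≡.refl = K.1<Q
    step : ∀ {Q} → q ℕ.^ m ≡ Q → (ρ′ : Fin n → K.Carrier) → Compatible F K (ρ ∘ suc) ρ′ →
           ¬ ¬ (∃ λ a → Compatible F K ρ (a VecF.∷ ρ′))
    step {Q} eq with 1<q^m eq
    -- Iterating x^q = x in F gives x^(q^m) = x, so each element of F is a root of X^|K| - X.
    step {suc (suc Q)} eq | s≤s (s≤s z≤n) = Extension.extend F K q Q cardF (≡.subst (HasCard K) eq cardK)
      (λ x → F.trans (F.reflexive (≡.cong (x F.^_) (≡.sym eq))) (F.fermat-iterated m x)) ρ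

  -- With all q elements of F as generators, R is F itself, and every law required of σ is a
  -- relation between generators that holds in F.
  embedding : ¬ ¬ Embedding F K
  embedding = do
    ρ′ , compatible ← compatible-extension F.elt
    return (fromCompatible ρ′ compatible)
    where
    fromCompatible : ∀ ρ′ → Compatible F K F.elt ρ′ → Embedding F K
    fromCompatible ρ′ compatible = record
      { σ      = λ x → ρ′ (F.idx x)
      ; σ-cong = λ x≈y → K.reflexive (≡.cong ρ′ (F.idx-cong x≈y))
      ; +-homo = λ x y → transfer (g (x F.+ y)) (g x `+ g y)
          (F.trans (F.elt-idx _) (F.sym (F.+-cong (F.elt-idx x) (F.elt-idx y))))
      ; *-homo = λ x y → transfer (g (x F.* y)) (g x `* g y)
          (F.trans (F.elt-idx _) (F.sym (F.*-cong (F.elt-idx x) (F.elt-idx y))))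
      ; 0-homo = transfer (g F.0#) `0 (F.elt-idx _)
      ; 1-homo = transfer (g F.1#) `1 (F.elt-idx _)
      }
      where
      g : F.Carrier → Expr q
      g x = gen (F.idx x)
      transfer : ∀ a b → F.⟦ a ⟧ F.elt F.≈ F.⟦ b ⟧ F.elt → K.⟦ a ⟧ ρ′ K.≈ K.⟦ b ⟧ ρ′
      transfer a b a≈b = K.x+-1*y≈0⇒x≈y
        (compatible (a `+ `-1 `* b) (F.trans (F.+-congʳ a≈b) (F.x+-1*x≈0 _)))

-- K as a vector space over F

funToFin-cong : ∀ {m n} {f g : Fin m → Fin n} → (∀ i → f i ≡ g i) → Fin.funToFin f ≡ Fin.funToFin g
funToFin-cong {zero}  f≗g = ≡.refl
funToFin-cong {suc m} f≗g = ≡.cong₂ Fin.combine (f≗g zero) (funToFin-cong (f≗g ∘ suc))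

module LinearCombinations {F K : Field} (ι : Embedding F K) where
  open Embedding ι
  private
    module F = Field F
    module K where
      open Field K public hiding (zero)
      open FieldProperties K public
  open MonoidSum K.+-commutativeMonoid using (sum; sum-cong-≋; ∑-distrib-+; sum-replicate-zero)
  open SemiringSum K.semiring using (*-distribˡ-sum)
  open SetoidReasoning K.setoid

  combination : ∀ {r} → (Fin r → K.Carrier) → (Fin r → F.Carrier) → K.Carrier
  combination e w = sum λ j → σ (w j) K.* e j

  Independent : ∀ {r} → (Fin r → K.Carrier) → Set
  Independent e = ∀ w → combination e w K.≈ K.0# → ∀ j → w j F.≈ F.0#

  InSpan : ∀ {r} → (Fin r → K.Carrier) → K.Carrier → Set
  InSpan e y = ∃ λ w → combination e w K.≈ y

  Basis : ℕ → Set
  Basis r = ∃ λ (e : Fin r → K.Carrier) → Independent e × (∀ y → InSpan e y)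

  module _ {r} (e : Fin r → K.Carrier) where

    combination-cong : ∀ {v w} → (∀ j → v j F.≈ w j) → combination e v K.≈ combination e w
    combination-cong v≈w = sum-cong-≋ λ j → K.*-congʳ (σ-cong (v≈w j))

    combination-0 : combination e (λ _ → F.0#) K.≈ K.0#
    combination-0 = K.trans (sum-cong-≋ λ j → K.trans (K.*-congʳ 0-homo) (K.zeroˡ (e j))) (sum-replicate-zero r)

    combination-+ : ∀ v w → combination e (λ j → v j F.+ w j) K.≈ combination e v K.+ combination e w
    combination-+ v w = K.trans
      (sum-cong-≋ λ j → K.trans (K.*-congʳ (+-homo (v j) (w j))) (K.distribʳ (e j) _ _))
      (∑-distrib-+ (λ j → σ (v j) K.* e j) (λ j → σ (w j) K.* e j))

    combination-* : ∀ a w → combination e (λ j → a F.* w j) K.≈ σ a K.* combination e w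
    combination-* a w = K.trans
      (sum-cong-≋ λ j → K.trans (K.*-congʳ (*-homo a (w j))) (K.*-assoc _ _ _))
      (K.sym (*-distribˡ-sum (σ a) (λ j → σ (w j) K.* e j)))

    combination-injective : Independent e → ∀ {v w} → combination e v K.≈ combination e w → ∀ j → v j F.≈ w j
    combination-injective independent {v} {w} eq j = FieldProperties.x+-1*y≈0⇒x≈y F (independent _ (begin
      combination e (λ j → v j F.+ (F.- F.1#) F.* w j)
        ≈⟨ combination-+ v (λ j → (F.- F.1#) F.* w j) ⟩
      combination e v K.+ combination e (λ j → (F.- F.1#) F.* w j)
        ≈⟨ K.+-cong eq (combination-* (F.- F.1#) w) ⟩
      combination e w K.+ σ (F.- F.1#) K.* combination e w
        ≈⟨ σ-1 (combination e w) ⟩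
      K.0# ∎) j)

  -- Dividing a relation with coefficient a of y by - a expresses y by the other vectors.
  solve-for : ∀ {r} (e : Fin r → K.Carrier) y a w → ¬ a F.≈ F.0# →
              σ a K.* y K.+ combination e w K.≈ K.0# → InSpan e y
  solve-for e y a w a≉0 eq = (λ j → u F.* w j) , (begin
    combination e (λ j → u F.* w j)           ≈⟨ combination-* e u w ⟩
    σ u K.* C                                 ≈⟨ K.+-identityˡ _ ⟨
    K.0# K.+ σ u K.* C                        ≈⟨ K.+-congʳ (σ-1 y) ⟨
    (y K.+ σ (F.- F.1#) K.* y) K.+ σ u K.* C  ≈⟨ K.+-congʳ (K.+-congˡ (K.*-congʳ (K.trans (σ-cong (F.sym ua≈-1)) (*-homo u a)))) ⟩
    (y K.+ (σ u K.* σ a) K.* y) K.+ σ u K.* C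
      ≈⟨ K.solve 4 (λ y U A C → (y K.:+ (U K.:* A) K.:* y) K.:+ U K.:* C K.:= y K.:+ U K.:* (A K.:* y K.:+ C)) K.refl y (σ u) (σ a) C ⟩
    y K.+ σ u K.* (σ a K.* y K.+ C)           ≈⟨ K.+-congˡ (K.trans (K.*-congˡ eq) (K.zeroʳ _)) ⟩
    y K.+ K.0#                                ≈⟨ K.+-identityʳ y ⟩
    y                                         ∎)
    where
    C = combination e w
    b = proj₁ (F.inverse a a≉0)
    u = (F.- F.1#) F.* b
    ua≈-1 : u F.* a F.≈ F.- F.1#
    ua≈-1 = F.trans (F.*-assoc _ b a) (F.trans (F.*-congˡ (F.trans (F.*-comm b a) (proj₂ (F.inverse a a≉0)))) (F.*-identityʳ _))

  module _ {q} (cardF : HasCard F q) where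
    open FiniteField F q cardF using (_≟_)

    -- Greedy selection: a vector is kept exactly when it lies outside the span of those kept so
    -- far, which preserves independence by `solve-for`.
    spanning-independent : ∀ {t} (y : Fin t → K.Carrier) →
      ¬ ¬ (∃₂ λ r (e : Fin r → K.Carrier) → Independent e × (∀ i → InSpan e (y i)))
    spanning-independent {zero}  y = return (0 , VecF.[] , (λ w _ ()) , λ ())
    spanning-independent {suc t} y = do
      r , e , independent , spans ← spanning-independent (y ∘ suc)
      no y₀∉ ← ¬¬-excluded-middle {A = InSpan e (y zero)}
        where yes y₀∈ → return (r , e , independent , λ { zero → y₀∈ ; (suc i) → spans i })
      return (suc r , y zero VecF.∷ e , extended independent y₀∉ , λ
        { zero    → F.1# VecF.∷ (λ _ → F.0#) , K.trans
            (K.+-cong (K.trans (K.*-congʳ 1-homo) (K.*-identityˡ _)) (combination-0 e)) (K.+-identityʳ _)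
        ; (suc i) → F.0# VecF.∷ proj₁ (spans i) , K.trans
            (K.+-congʳ (K.trans (K.*-congʳ 0-homo) (K.zeroˡ _))) (K.trans (K.+-identityˡ _) (proj₂ (spans i))) })
      where
      extended : ∀ {r} {e : Fin r → K.Carrier} → Independent e → ¬ InSpan e (y zero) → Independent (y zero VecF.∷ e)
      extended {e = e} independent y₀∉ w eq with w zero ≟ F.0#
      ... | no w₀≉0 = contradiction (solve-for e (y zero) (w zero) (w ∘ suc) w₀≉0 eq) y₀∉
      ... | yes w₀≈0 = λ
        { zero    → w₀≈0
        ; (suc j) → independent (w ∘ suc) (begin
            combination e (w ∘ suc)                                ≈⟨ K.+-identityˡ _ ⟨
            K.0# K.+ combination e (w ∘ suc)                       ≈⟨ K.+-congʳ (K.trans (K.*-congʳ (K.trans (σ-cong w₀≈0) 0-homo)) (K.zeroˡ _)) ⟨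
            σ (w zero) K.* y zero K.+ combination e (w ∘ suc)      ≈⟨ eq ⟩
            K.0#                                                   ∎) j }

    module _ {m} (1<q : 1 ℕ.< q) (cardK : HasCard K (q ℕ.^ m)) where
      private
        module F# = FiniteField F q cardF
        module K# = FiniteField K (q ℕ.^ m) cardK

      -- Counting: forming combinations injects q^r coefficient vectors into K by independence, and
      -- choosing coefficients injects the q^m elements of K back. Hence q^r = q^m.
      basis-size : ∀ {r} → Basis r → r ≡ m
      basis-size {r} (e , independent , spans) =
        ℕ.≤-antisym (^-cancel-≤ (Fin.injective⇒≤ {f = toK} toK-injective)) (^-cancel-≤ (Fin.injective⇒≤ {f = fromK} fromK-injective))
        where
        ^-cancel-≤ : ∀ {a b} → q ℕ.^ a ℕ.≤ q ℕ.^ b → a ℕ.≤ b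
        ^-cancel-≤ le = ℕ.≮⇒≥ λ b<a → ℕ.<⇒≱ (ℕ.^-monoʳ-< q 1<q b<a) le
        toK : Fin (q ℕ.^ r) → Fin (q ℕ.^ m)
        toK i = K#.idx (combination e (F#.elt ∘ Fin.finToFun i))
        toK-injective : ∀ {i j} → toK i ≡ toK j → i ≡ j
        toK-injective {i} {j} eq = finToFun-injective λ l → F#.elt-injective _ _ (combination-injective e independent (K#.idx-injective eq) l)
          where
          finToFun-injective : (∀ l → Fin.finToFun {q} {r} i l ≡ Fin.finToFun j l) → i ≡ j
          finToFun-injective h = ≡.trans (≡.sym (Fin.funToFin-finToFin {r} {q} i)) (≡.trans (funToFin-cong h) (Fin.funToFin-finToFin {r} {q} j))
        fromK : Fin (q ℕ.^ m) → Fin (q ℕ.^ r)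
        fromK i = Fin.funToFin (F#.idx ∘ proj₁ (spans (K#.elt i)))
        fromK-injective : ∀ {i j} → fromK i ≡ fromK j → i ≡ j
        fromK-injective {i} {j} eq = K#.elt-injective i j (begin
          K#.elt i                                     ≈⟨ proj₂ (spans (K#.elt i)) ⟨
          combination e (proj₁ (spans (K#.elt i)))     ≈⟨ combination-cong e (λ l → F#.idx-injective (same l)) ⟩
          combination e (proj₁ (spans (K#.elt j)))     ≈⟨ proj₂ (spans (K#.elt j)) ⟩
          K#.elt j                                     ∎)
          where
          same : ∀ l → F#.idx (proj₁ (spans (K#.elt i)) l) ≡ F#.idx (proj₁ (spans (K#.elt j)) l)
          same l = ≡.trans (≡.sym (Fin.finToFun-funToFin _ l)) (≡.trans (≡.cong (λ k → Fin.finToFun k l) eq) (Fin.finToFun-funToFin _ l))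

      basis-exists : ¬ ¬ Basis m
      basis-exists = do
        r , e , independent , spans ← spanning-independent K#.elt
        let b = e , independent , λ y → proj₁ (spans (K#.idx y)) , K.trans (proj₂ (spans (K#.idx y))) (K#.elt-idx y)
        return (≡.subst Basis (basis-size b) b)

-- Restriction of scalars

module RestrictionOfScalars {F K : Field} (ι : Embedding F K) {m} (basis : LinearCombinations.Basis ι m) (n : ℕ) where
  open Embedding ι
  open LinearCombinations ι
  private
    module F = Field F
    module K where
      open Field K public hiding (zero)
      open FieldProperties K public
    module VF = LinAlg F (Fin n × Fin m)
    module VK = LinAlg K (Fin n)
    e = proj₁ basis
    independent-e : Independent e
    independent-e = proj₁ (proj₂ basis)
  open MonoidSum K.+-commutativeMonoid using (sum; sum-cong-≋)
  open SemiringSum K.semiring using (*-distribʳ-sum)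
  open SetoidReasoning K.setoid

  coordinates : K.Carrier → Fin m → F.Carrier
  coordinates y = proj₁ (proj₂ (proj₂ basis) y)

  combination-coordinates : ∀ y → combination e (coordinates y) K.≈ y
  combination-coordinates y = proj₂ (proj₂ (proj₂ basis) y)

  -- Each block becomes one entry, so that shifting blocks corresponds to shifting entries.
  toK : VF.V → VK.V
  toK w i = combination e λ j → w (i , j)

  toK-injective : ∀ {v w} → toK v VK.≈ᵥ toK w → v VF.≈ᵥ w
  toK-injective eq (i , j) = combination-injective e independent-e (eq i) j

  restriction : (VK.V → Set) → VF.V → Set
  restriction U w = U (toK w)

  restriction-isSubspace : ∀ {U} → VK.IsSubspace U → VF.IsSubspace (restriction U)
  restriction-isSubspace isSubspace = record
    { resp  = λ u≈v → resp λ i → combination-cong e λ j → u≈v (i , j)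
    ; zero∈ = resp (λ i → K.sym (combination-0 e)) zero∈
    ; +∈    = λ u∈ v∈ → resp (λ i → K.sym (combination-+ e _ _)) (+∈ u∈ v∈)
    ; ·∈    = λ a u∈ → resp (λ i → K.sym (combination-* e a _)) (·∈ (σ a) u∈)
    }
    where open VK.IsSubspace isSubspace

  iter-τ₃idx : ∀ k (i : Fin n) (j : Fin m) → iter τ₃idx k (i , j) ≡ (iter cpred k i , j)
  iter-τ₃idx zero    i j = ≡.refl
  iter-τ₃idx (suc k) i j = ≡.cong τ₃idx (iter-τ₃idx k i j)

  restriction-covering : ∀ {U} → VK.IsSubspace U → VK.Covering cpred n U → VF.Covering τ₃idx n (restriction U)
  restriction-covering isSubspace covering v with covering (toK v)
  ... | k , u , u∈ , v≈u = k , w , VK.IsSubspace.resp isSubspace (λ i → K.sym (combination-coordinates (u i))) u∈ ,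
    λ { (i , j) → F.trans (combination-injective e independent-e (K.trans (v≈u i) (K.sym (combination-coordinates _))) j)
                          (F.reflexive (≡.cong w (≡.sym (iter-τ₃idx (Fin.toℕ k) i j)))) }
    where
    w : VF.V
    w (i , j) = coordinates (u i) j

  sum-↑ : ∀ k {l} (f : Fin (k ℕ.+ l) → K.Carrier) → sum f K.≈ sum (λ i → f (i Fin.↑ˡ l)) K.+ sum (λ j → f (k Fin.↑ʳ j))
  sum-↑ zero    f = K.sym (K.+-identityˡ _)
  sum-↑ (suc k) f = K.trans (K.+-congˡ (sum-↑ k (f ∘ suc))) (K.sym (K.+-assoc _ _ _))

  sum-combine : ∀ d {l} (f : Fin (d ℕ.* l) → K.Carrier) → sum f K.≈ sum (λ i → sum (λ j → f (Fin.combine {d} {l} i j)))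
  sum-combine zero        f = K.refl
  sum-combine (suc d) {l} f = K.trans (sum-↑ l f) (K.+-congˡ (sum-combine d (λ k → f (l Fin.↑ʳ k))))

  lincomb≡sum : ∀ d c b i → VK.lincomb d c b i ≡ sum (λ k → c k K.* b k i)
  lincomb≡sum zero    c b i = ≡.refl
  lincomb≡sum (suc d) c b i = ≡.cong (c zero K.* b zero i K.+_) (lincomb≡sum d (c ∘ suc) (b ∘ suc) i)

  toK-lincomb : ∀ d c b i → toK (VF.lincomb d c b) i K.≈ sum (λ k → σ (c k) K.* toK (b k) i)
  toK-lincomb zero    c b i = combination-0 e
  toK-lincomb (suc d) c b i = K.trans (combination-+ e (λ j → c zero F.* b zero (i , j)) (λ j → VF.lincomb d (c ∘ suc) (b ∘ suc) (i , j)))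
    (K.+-cong (combination-* e (c zero) (λ j → b zero (i , j))) (toK-lincomb d (c ∘ suc) (b ∘ suc) i))

  module _ {d} (b : Fin d → VK.V) where

    -- The basis from the tower law: products of basis elements of K over F with basis vectors of U
    -- over K, written in coordinates.
    product-basis : Fin (d ℕ.* m) → VF.V
    product-basis k (i , l) = let k₁ , k₂ = Fin.remQuot {d} m k in coordinates (e k₂ K.* b k₁ i) l

    toK-product-basis : ∀ k₁ k₂ i → toK (product-basis (Fin.combine k₁ k₂)) i K.≈ e k₂ K.* b k₁ i
    toK-product-basis k₁ k₂ i = K.trans (combination-coordinates _)
      (K.reflexive (≡.cong (λ { (i₁ , i₂) → e i₂ K.* b i₁ i }) (Fin.remQuot-combine {d} {m} k₁ k₂)))

    -- Regrouping by the vectors of b turns an F-combination into a K-combination whose coefficients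
    -- have the rows of c as coordinates. Independence and spanning over F then follow in two
    -- stages, through b over K and through e over F.
    toK-lincomb-product-basis : ∀ c → toK (VF.lincomb (d ℕ.* m) c product-basis) VK.≈ᵥ
      VK.lincomb d (λ k₁ → combination e (λ k₂ → c (Fin.combine k₁ k₂))) b
    toK-lincomb-product-basis c i = begin
      toK (VF.lincomb (d ℕ.* m) c product-basis) i
        ≈⟨ toK-lincomb (d ℕ.* m) c product-basis i ⟩
      sum (λ k → σ (c k) K.* toK (product-basis k) i)
        ≈⟨ sum-combine d _ ⟩
      sum {d} (λ k₁ → sum {m} (λ k₂ → σ (c (Fin.combine k₁ k₂)) K.* toK (product-basis (Fin.combine k₁ k₂)) i))
        ≈⟨ sum-cong-≋ {d} (λ k₁ → sum-cong-≋ {m} (λ k₂ →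
             K.trans (K.*-congˡ (toK-product-basis k₁ k₂ i)) (K.sym (K.*-assoc _ _ _)))) ⟩
      sum {d} (λ k₁ → sum {m} (λ k₂ → σ (c (Fin.combine k₁ k₂)) K.* e k₂ K.* b k₁ i))
        ≈⟨ sum-cong-≋ {d} (λ k₁ → *-distribʳ-sum (b k₁ i) (λ k₂ → σ (c (Fin.combine k₁ k₂)) K.* e k₂)) ⟨
      sum (λ k₁ → combination e (λ k₂ → c (Fin.combine k₁ k₂)) K.* b k₁ i)
        ≡⟨ lincomb≡sum d _ b i ⟨
      VK.lincomb d (λ k₁ → combination e (λ k₂ → c (Fin.combine k₁ k₂))) b i ∎

  lincomb-cong : ∀ d {c c′} b → (∀ k → c k K.≈ c′ k) → VK.lincomb d c b VK.≈ᵥ VK.lincomb d c′ b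
  lincomb-cong zero    b c≈c′ i = K.refl
  lincomb-cong (suc d) b c≈c′ i = K.+-cong (K.*-congʳ (c≈c′ zero)) (lincomb-cong d (b ∘ suc) (c≈c′ ∘ suc) i)

  restriction-dim : ∀ {U d} → VK.IsSubspace U → VK.HasDim U d → VF.HasDim (restriction U) (d ℕ.* m)
  restriction-dim {U} {d} isSubspace (b , b∈ , independent , spans) =
    product-basis b , product-basis∈ , product-independent , product-spans
    where
    open VK.IsSubspace isSubspace

    product-basis∈ : ∀ k → restriction U (product-basis b k)
    product-basis∈ k = let k₁ , k₂ = Fin.remQuot {d} m k in
      resp (λ i → K.sym (combination-coordinates (e k₂ K.* b k₁ i))) (·∈ (e k₂) (b∈ k₁))

    product-independent : ∀ c → VF.lincomb (d ℕ.* m) c (product-basis b) VF.≈ᵥ VF.0ᵥ → ∀ k → c k F.≈ F.0#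
    product-independent c eq k = F.trans
      (F.reflexive (≡.cong c (≡.sym (Fin.combine-remQuot {d} m k))))
      (let k₁ , k₂ = Fin.remQuot {d} m k in independent-e (λ l → c (Fin.combine k₁ l))
        (independent (λ k₁ → combination e (λ k₂ → c (Fin.combine k₁ k₂))) (λ i → begin
          VK.lincomb d (λ k₁ → combination e (λ k₂ → c (Fin.combine k₁ k₂))) b i  ≈⟨ toK-lincomb-product-basis b c i ⟨
          toK (VF.lincomb (d ℕ.* m) c (product-basis b)) i                         ≈⟨ combination-cong e (λ j → eq (i , j)) ⟩
          combination e (λ _ → F.0#)                                               ≈⟨ combination-0 e ⟩
          K.0#                                                                     ∎) k₁) k₂)

    product-spans : ∀ w → restriction U w → ∃ λ c → w VF.≈ᵥ VF.lincomb (d ℕ.* m) c (product-basis b)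
    product-spans w w∈ with spans (toK w) w∈
    ... | C , w≈ = c , toK-injective (λ i → begin
      toK w i                                                                  ≈⟨ w≈ i ⟩
      VK.lincomb d C b i                                                       ≈⟨ lincomb-cong d b C≈c i ⟩
      VK.lincomb d (λ k₁ → combination e (λ k₂ → c (Fin.combine k₁ k₂))) b i  ≈⟨ toK-lincomb-product-basis b c i ⟨
      toK (VF.lincomb (d ℕ.* m) c (product-basis b)) i                         ∎)
      where
      c : Fin (d ℕ.* m) → F.Carrier
      c k = let k₁ , k₂ = Fin.remQuot {d} m k in coordinates (C k₁) k₂
      C≈c : ∀ k₁ → C k₁ K.≈ combination e (λ k₂ → c (Fin.combine k₁ k₂))
      C≈c k₁ = K.trans (K.sym (combination-coordinates (C k₁))) (combination-cong e λ k₂ →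
        F.reflexive (≡.cong (λ { (i , j) → coordinates (C i) j }) (≡.sym (Fin.remQuot-combine {d} {m} k₁ k₂))))

  hτ₃Le⇒dim-bound : ∀ {h} → hτ₃Le F m n h → ∀ {U d} → VK.IsSubspace U → VK.Covering cpred n U → VK.HasDim U d →
                    m ℕ.* n ∸ d ℕ.* m ℕ.≤ h
  hτ₃Le⇒dim-bound hτ₃ {U} isSubspace covering dim =
    hτ₃ (restriction U) (restriction-isSubspace isSubspace) (restriction-covering isSubspace covering) _
      (restriction-dim isSubspace dim)

-- The block shift as a power of the cyclic shift

iter-+ : ∀ {A : Set} (f : A → A) s t x → iter f (s ℕ.+ t) x ≡ iter f s (iter f t x)
iter-+ f zero    t x = ≡.refl
iter-+ f (suc s) t x = ≡.cong f (iter-+ f s t x)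

toℕ-cpred-suc : ∀ {N} (x : Fin N) {a} → Fin.toℕ x ≡ suc a → Fin.toℕ (cpred x) ≡ a
toℕ-cpred-suc (suc x) eq = ≡.trans (Fin.toℕ-inject₁ x) (ℕ.suc-injective eq)

toℕ-cpred-zero : ∀ {N} (x : Fin N) → Fin.toℕ x ≡ 0 → suc (Fin.toℕ (cpred x)) ≡ N
toℕ-cpred-zero {suc N} zero eq = ≡.cong suc (Fin.toℕ-fromℕ N)

-- Starting at position t + a, the first t backward steps do not wrap around.
toℕ-iter-cpred : ∀ {N} t (x : Fin N) {a} → Fin.toℕ x ≡ t ℕ.+ a → Fin.toℕ (iter cpred t x) ≡ a
toℕ-iter-cpred zero    x eq = eq
toℕ-iter-cpred (suc t) x eq = toℕ-cpred-suc (iter cpred t x) (toℕ-iter-cpred t x (≡.trans eq (≡.sym (ℕ.+-suc t _))))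

-- τᵐ = τ₃. In the first block the shift wraps around after toℕ j steps.
iter-cpred-combine : ∀ {n m} (i : Fin n) (j : Fin m) → iter cpred m (Fin.combine i j) ≡ Fin.combine (cpred i) j
iter-cpred-combine {suc n} {m} (suc i) j = Fin.toℕ-injective (≡.trans
  (toℕ-iter-cpred m (Fin.combine (suc i) j) (begin
    Fin.toℕ (Fin.combine (suc i) j)              ≡⟨ Fin.toℕ-combine (suc i) j ⟩
    m ℕ.* suc (Fin.toℕ i) ℕ.+ Fin.toℕ j          ≡⟨ ≡.cong (ℕ._+ Fin.toℕ j) (ℕ.*-suc m (Fin.toℕ i)) ⟩
    m ℕ.+ m ℕ.* Fin.toℕ i ℕ.+ Fin.toℕ j          ≡⟨ ℕ.+-assoc m _ _ ⟩
    m ℕ.+ (m ℕ.* Fin.toℕ i ℕ.+ Fin.toℕ j)        ∎))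
  (begin
    m ℕ.* Fin.toℕ i ℕ.+ Fin.toℕ j                ≡⟨ ≡.cong (λ x → m ℕ.* x ℕ.+ Fin.toℕ j) (Fin.toℕ-inject₁ i) ⟨
    m ℕ.* Fin.toℕ (Fin.inject₁ i) ℕ.+ Fin.toℕ j  ≡⟨ Fin.toℕ-combine (Fin.inject₁ i) j ⟨
    Fin.toℕ (Fin.combine (Fin.inject₁ i) j)      ∎))
  where open ≡.≡-Reasoning
iter-cpred-combine {suc n} {m} zero j = Fin.toℕ-injective (begin
  Fin.toℕ (iter cpred m x)                             ≡⟨ ≡.cong (λ t → Fin.toℕ (iter cpred t x)) m≡s+1+j ⟩
  Fin.toℕ (iter cpred (s ℕ.+ suc (Fin.toℕ j)) x)       ≡⟨ ≡.cong Fin.toℕ (iter-+ cpred s (suc (Fin.toℕ j)) x) ⟩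
  Fin.toℕ (iter cpred s (cpred (iter cpred (Fin.toℕ j) x)))  ≡⟨ toℕ-iter-cpred s _ (ℕ.suc-injective last) ⟩
  Fin.toℕ j ℕ.+ n ℕ.* m                                ≡⟨ ℕ.+-comm (Fin.toℕ j) _ ⟩
  n ℕ.* m ℕ.+ Fin.toℕ j                                ≡⟨ ≡.cong (ℕ._+ Fin.toℕ j) (ℕ.*-comm n m) ⟩
  m ℕ.* n ℕ.+ Fin.toℕ j                                ≡⟨ ≡.cong (λ x → m ℕ.* x ℕ.+ Fin.toℕ j) (Fin.toℕ-fromℕ n) ⟨
  m ℕ.* Fin.toℕ (Fin.fromℕ n) ℕ.+ Fin.toℕ j            ≡⟨ Fin.toℕ-combine (Fin.fromℕ n) j ⟨
  Fin.toℕ (Fin.combine (Fin.fromℕ n) j)                ∎)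
  where
  open ≡.≡-Reasoning
  x : Fin (suc n ℕ.* m)
  x = Fin.combine (zero {n}) j
  s : ℕ
  s = m ∸ suc (Fin.toℕ j)
  m≡s+1+j : m ≡ s ℕ.+ suc (Fin.toℕ j)
  m≡s+1+j = ≡.sym (ℕ.m∸n+n≡m (Fin.toℕ<n j))
  x≡j : Fin.toℕ x ≡ Fin.toℕ j ℕ.+ 0
  x≡j = ≡.trans (Fin.toℕ-↑ˡ j (n ℕ.* m)) (≡.sym (ℕ.+-identityʳ _))
  last : suc (Fin.toℕ (cpred (iter cpred (Fin.toℕ j) x))) ≡ suc (s ℕ.+ (Fin.toℕ j ℕ.+ n ℕ.* m))
  last = begin
    suc (Fin.toℕ (cpred (iter cpred (Fin.toℕ j) x)))   ≡⟨ toℕ-cpred-zero _ (toℕ-iter-cpred (Fin.toℕ j) x x≡j) ⟩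
    m ℕ.+ n ℕ.* m                                      ≡⟨ ≡.cong (ℕ._+ n ℕ.* m) m≡s+1+j ⟩
    s ℕ.+ suc (Fin.toℕ j) ℕ.+ n ℕ.* m                  ≡⟨ ℕ.+-assoc s _ _ ⟩
    s ℕ.+ suc (Fin.toℕ j ℕ.+ n ℕ.* m)                  ≡⟨ ℕ.+-suc s _ ⟩
    suc (s ℕ.+ (Fin.toℕ j ℕ.+ n ℕ.* m))                ∎

remQuot-iter-cpred : ∀ {n m} k (x : Fin (n ℕ.* m)) →
  Fin.remQuot {n} m (iter cpred (k ℕ.* m) x) ≡ iter τ₃idx k (Fin.remQuot {n} m x)
remQuot-iter-cpred         zero    x = ≡.refl
remQuot-iter-cpred {n} {m} (suc k) x = begin
  Fin.remQuot m (iter cpred (m ℕ.+ k ℕ.* m) x)              ≡⟨ ≡.cong (Fin.remQuot m) (iter-+ cpred m (k ℕ.* m) x) ⟩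
  Fin.remQuot m (iter cpred m y)                            ≡⟨ ≡.cong (Fin.remQuot m ∘ iter cpred m) (Fin.combine-remQuot {n} m y) ⟨
  Fin.remQuot m (iter cpred m (Fin.combine i j))            ≡⟨ ≡.cong (Fin.remQuot m) (iter-cpred-combine i j) ⟩
  Fin.remQuot m (Fin.combine (cpred i) j)                   ≡⟨ Fin.remQuot-combine (cpred i) j ⟩
  τ₃idx (Fin.remQuot {n} m y)                               ≡⟨ ≡.cong τ₃idx (remQuot-iter-cpred {n} k x) ⟩
  τ₃idx (iter τ₃idx k (Fin.remQuot {n} m x))                ∎
  where
  open ≡.≡-Reasoning
  y : Fin (n ℕ.* m)
  y = iter cpred (k ℕ.* m) x
  i = proj₁ (Fin.remQuot {n} m y)
  j = proj₂ (Fin.remQuot {n} m y)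

-- From blocks to a single cyclic sequence

module Reindexing (F : Field) (n m : ℕ) (0<m : 0 ℕ.< m) where
  open Field F using (trans; reflexive; _+_; _*_)
  private
    module A = LinAlg F (Fin n × Fin m)
    module B = LinAlg F (Fin (n ℕ.* m))
    split : Fin (n ℕ.* m) → Fin n × Fin m
    split = Fin.remQuot {n} m
    join : Fin n × Fin m → Fin (n ℕ.* m)
    join (i , j) = Fin.combine i j

  flatten : (A.V → Set) → B.V → Set
  flatten U w = U (w ∘ join)

  flatten-isSubspace : ∀ {U} → A.IsSubspace U → B.IsSubspace (flatten U)
  flatten-isSubspace isSubspace = record
    { resp  = λ u≈v → resp (u≈v ∘ join)
    ; zero∈ = zero∈
    ; +∈    = λ u∈ v∈ → +∈ u∈ v∈
    ; ·∈    = λ a u∈ → ·∈ a u∈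
    }
    where open A.IsSubspace isSubspace

  join-split : ∀ (w : A.V) → w A.≈ᵥ (w ∘ split ∘ join)
  join-split w (i , j) = reflexive (≡.cong w (≡.sym (Fin.remQuot-combine i j)))

  -- The k-th power of τ₃ is the power k m of τ, and k m < n m because m is positive, so it is one
  -- of the shifts allowed in a cyclic covering.
  flatten-covering : ∀ {U} → A.IsSubspace U → A.Covering τ₃idx n U → B.Covering cpred (n ℕ.* m) (flatten U)
  flatten-covering isSubspace covering v with covering (v ∘ join)
  ... | k , u , u∈ , v≈u = Fin.fromℕ< km<nm , u ∘ split , A.IsSubspace.resp isSubspace (join-split u) u∈ , λ x →
    trans (reflexive (≡.cong v (≡.sym (Fin.combine-remQuot {n} m x)))) (trans (v≈u (split x)) (reflexive (≡.cong u (begin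
      iter τ₃idx (Fin.toℕ k) (split x)                             ≡⟨ remQuot-iter-cpred {n} (Fin.toℕ k) x ⟨
      split (iter cpred (Fin.toℕ k ℕ.* m) x)                       ≡⟨ ≡.cong (λ t → split (iter cpred t x)) (Fin.toℕ-fromℕ< km<nm) ⟨
      split (iter cpred (Fin.toℕ (Fin.fromℕ< km<nm)) x)            ∎))))
    where
    open ≡.≡-Reasoning
    km<nm : Fin.toℕ k ℕ.* m ℕ.< n ℕ.* m
    km<nm = ℕ.*-monoˡ-< m {{ℕ.>-nonZero 0<m}} (Fin.toℕ<n k)

  lincomb-reindex : ∀ d c b x → B.lincomb d c (λ k → b k ∘ split) x ≡ A.lincomb d c b (split x)
  lincomb-reindex zero    c b x = ≡.refl
  lincomb-reindex (suc d) c b x = ≡.cong (c zero * b zero (split x) +_) (lincomb-reindex d (c ∘ suc) (b ∘ suc) x)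

  flatten-dim : ∀ {U d} → A.IsSubspace U → A.HasDim U d → B.HasDim (flatten U) d
  flatten-dim {U} {d} isSubspace (b , b∈ , independent , spans) =
    (λ k → b k ∘ split) ,
    (λ k → A.IsSubspace.resp isSubspace (join-split (b k)) (b∈ k)) ,
    (λ c eq → independent c λ p → trans (join-split (A.lincomb d c b) p)
      (trans (reflexive (≡.sym (lincomb-reindex d c b (join p)))) (eq (join p)))) ,
    λ w w∈ → let c , w≈ = spans (w ∘ join) w∈ in c , λ x →
      trans (reflexive (≡.cong w (≡.sym (Fin.combine-remQuot {n} m x))))
        (trans (w≈ (split x)) (reflexive (≡.sym (lincomb-reindex d c b x))))

  -- `Fin.combine` numbers the coordinates by n m while the bound is stated for m n; hence the two
  -- transports along commutativity.
  hLe⇒hτ₃Le : ∀ {h} → hLe F (m ℕ.* n) h → hτ₃Le F m n h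
  hLe⇒hτ₃Le {h} bound U isSubspace covering d dim =
    ≡.subst (λ N → N ∸ d ℕ.≤ h) (ℕ.*-comm n m)
      (≡.subst (λ N → hLe F N h) (ℕ.*-comm m n) bound
        (flatten U) (flatten-isSubspace isSubspace) (flatten-covering isSubspace covering) d (flatten-dim isSubspace dim))

-- The left-hand side is the multiple m (n - d) of m, and the only multiple of m below m is 0.
∸-cancel-≤pred : ∀ m n d {h} → 0 ℕ.< m → h ℕ.≤ m ∸ 1 → m ℕ.* n ∸ d ℕ.* m ℕ.≤ h → n ∸ d ℕ.≤ 0
∸-cancel-≤pred m@(suc m-1) n d 0<m h<m le with n ∸ d in eq
... | zero  = z≤n
... | suc k = contradiction (ℕ.≤-trans (≡.subst (m ℕ.≤_) block (ℕ.m≤m+n m (k ℕ.* m))) (ℕ.≤-trans le h<m)) (ℕ.<-irrefl ≡.refl)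
  where
  open ≡.≡-Reasoning
  block : suc k ℕ.* m ≡ m ℕ.* n ∸ d ℕ.* m
  block = begin
    suc k ℕ.* m            ≡⟨ ≡.cong (ℕ._* m) eq ⟨
    (n ∸ d) ℕ.* m          ≡⟨ ℕ.*-distribʳ-∸ m n d ⟩
    n ℕ.* m ∸ d ℕ.* m      ≡⟨ ≡.cong (_∸ d ℕ.* m) (ℕ.*-comm n m) ⟩
    m ℕ.* n ∸ d ℕ.* m      ∎

-- Taken with h = 0 and with h = m - 1, it yields both assertions about h over K.
hτ₃Le⇒hLe-extension : ∀ {q m n h} → IsPrimePower q → 0 ℕ.< m → (F : Field) → HasCard F q →
  (K : Field) → HasCard K (q ℕ.^ m) → h ℕ.≤ m ∸ 1 → hτ₃Le F m n h → hLe K n 0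
hτ₃Le⇒hLe-extension {q} {m} {n} isPrimePower 0<m F cardF K cardK h<m bound U isSubspace covering d dim =
  decidable-stable (n ∸ d ℕ.≤? 0) do
    ι ← embedding {q} {m} isPrimePower F K cardF cardK
    basis ← LinearCombinations.basis-exists ι cardF (FiniteField.1<Q F q cardF) cardK
    return (∸-cancel-≤pred m n d 0<m h<m
      (RestrictionOfScalars.hτ₃Le⇒dim-bound ι basis n bound isSubspace covering dim))

open import Data.Nat using (_*_; _^_; _<_)

theorem4p3 : (q m n : ℕ) → IsPrimePower q → 0 < m → 0 < n →
    (F : Field) → HasCard F q → (K : Field) → HasCard K (q ^ m) →
    (hLe F (m * n) 0 → hτ₃Le F m n 0 × hLe K n 0)
    × (hLe F (m * n) (m ∸ 1) → hLe K n 0)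
theorem4p3 q m n isPrimePower 0<m 0<n F cardF K cardK =
    (λ h≤0 → hLe⇒hτ₃Le h≤0 , hτ₃Le⇒hLe-extension isPrimePower 0<m F cardF K cardK z≤n (hLe⇒hτ₃Le h≤0))
  , (λ h≤m-1 → hτ₃Le⇒hLe-extension isPrimePower 0<m F cardF K cardK ℕ.≤-refl (hLe⇒hτ₃Le h≤m-1))
  where open Reindexing F n m 0<m
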